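{- Let $c=\sqrt{\sqrt{2}+1}$ (so $c\ge 1.55$). For all sufficiently large $n$, $$|T(\mathcal{G}_{\mathrm{all}}(n))|\ \ge\ |T(\mathcal{G}_{\mathrm{pla}}(n))|\ \ge\ 0.9\,c^n .$$
   Context: All graphs are simple. For a graph $G$, $\tau(G)$ denotes the number of spanning trees of $G$. $\mathcal{G}_{\mathrm{all}}(n)$ denotes the family of all (simple) graphs on $n$ vertices and $\mathcal{G}_{\mathrm{pla}}(n)$ the family of all (simple) planar graphs on $n$ vertices. For a family $\mathcal{G}$ of graphs, its tree spectrum is $T(\mathcal{G}):=\{\tau(G): G\in\mathcal{G}\}$. -}

module Defs where

open import Data.Nat as ℕ using (ℕ; zero; suc; _+_; _*_; _∸_; _≤_; _<_)
open import Data.Integer as ℤ using (ℤ; +_)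
open import Data.Fin using (Fin; zero; suc; inject₁; fromℕ)
open import Data.Vec using (Vec; lookup)
open import Data.Bool using (Bool; true; false)
open import Data.List using (List; length)
open import Data.List.Membership.Propositional using (_∈_)
open import Data.List.Relation.Unary.Unique.Propositional using (Unique)
open import Data.Product using (Σ; ∃; _×_; _,_)
open import Function.Bundles using (_⇔_)
open import Function.Definitions using (Injective)
open import Relation.Binary.PropositionalEquality using (_≡_; _≢_)
open import Relation.Nullary using (¬_)

Adjacency : ℕ → Set
Adjacency n = Vec (Vec Bool n) n

Adj : ∀ {n} → Adjacency n → Fin n → Fin n → Set
Adj A i j = lookup (lookup A i) j ≡ true

IsSimple : ∀ {n} → Adjacency n → Set
IsSimple {n} A =
  (∀ (i j : Fin n) → lookup (lookup A i) j ≡ lookup (lookup A j) i) ×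
  (∀ (i : Fin n) → lookup (lookup A i) i ≡ false)

_⊆ᴳ_ : ∀ {n} → Adjacency n → Adjacency n → Set
_⊆ᴳ_ {n} H G = ∀ (i j : Fin n) → Adj H i j → Adj G i j

data Walk {n} (A : Adjacency n) : Fin n → Fin n → Set where
  here : ∀ {i} → Walk A i i
  step : ∀ {i j k} → Adj A i j → Walk A j k → Walk A i k

Connected : ∀ {n} → Adjacency n → Set
Connected {n} A = ∀ (i j : Fin n) → Walk A i j

HasCycle : ∀ {n} → Adjacency n → Set
HasCycle {n} A =
  Σ ℕ λ k → Σ (Fin (3 + k) → Fin n) λ v →
    Injective _≡_ _≡_ v ×
    (∀ (i : Fin (2 + k)) → Adj A (v (inject₁ i)) (v (suc i))) ×
    Adj A (v (fromℕ (2 + k))) (v zero)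

IsTree : ∀ {n} → Adjacency n → Set
IsTree A = Connected A × ¬ HasCycle A

IsSpanningTreeOf : ∀ {n} → Adjacency n → Adjacency n → Set
IsSpanningTreeOf G H = IsSimple H × (H ⊆ᴳ G) × IsTree H

HasCount : {A : Set} → (A → Set) → ℕ → Set
HasCount {A} P k =
  Σ (List A) λ xs → (length xs ≡ k) × Unique xs × (∀ x → (x ∈ xs) ⇔ P x)

NumSpanningTrees : ∀ {n} → Adjacency n → ℕ → Set
NumSpanningTrees G k = HasCount (IsSpanningTreeOf G) k

-- Planarity: a crossing-free straight-line drawing with integer coordinates
-- (equivalent to planarity by Fáry's theorem plus perturbation/scaling).

Point : Set
Point = ℤ × ℤ

OnSegment : Point → Point → Point → Set
OnSegment (wx , wy) (px , py) (qx , qy) =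
  Σ ℕ λ d → Σ ℕ λ s → (0 < d) × (s ≤ d) ×
    ((+ d) ℤ.* wx ≡ (+ (d ∸ s)) ℤ.* px ℤ.+ (+ s) ℤ.* qx) ×
    ((+ d) ℤ.* wy ≡ (+ (d ∸ s)) ℤ.* py ℤ.+ (+ s) ℤ.* qy)

-- closed segments pq and ru have a common point (necessarily a rational one)
SegmentsMeet : Point → Point → Point → Point → Set
SegmentsMeet (px , py) (qx , qy) (rx , ry) (ux , uy) =
  Σ ℕ λ d → Σ ℕ λ s → Σ ℕ λ t → (0 < d) × (s ≤ d) × (t ≤ d) ×
    ((+ (d ∸ s)) ℤ.* px ℤ.+ (+ s) ℤ.* qx ≡ (+ (d ∸ t)) ℤ.* rx ℤ.+ (+ t) ℤ.* ux) ×
    ((+ (d ∸ s)) ℤ.* py ℤ.+ (+ s) ℤ.* qy ≡ (+ (d ∸ t)) ℤ.* ry ℤ.+ (+ t) ℤ.* uy)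

IsPlaneDrawing : ∀ {n} → Adjacency n → (Fin n → Point) → Set
IsPlaneDrawing {n} G pos =
  Injective _≡_ _≡_ pos ×
  (∀ (u v w : Fin n) → Adj G u v → w ≢ u → w ≢ v → ¬ OnSegment (pos w) (pos u) (pos v)) ×
  (∀ (a b c d : Fin n) → Adj G a b → Adj G c d →
     a ≢ c → a ≢ d → b ≢ c → b ≢ d →
     ¬ SegmentsMeet (pos a) (pos b) (pos c) (pos d))
  -- (edges sharing an endpoint can then only meet at that endpoint)

IsPlanar : ∀ {n} → Adjacency n → Set
IsPlanar {n} G = Σ (Fin n → Point) (IsPlaneDrawing G)

Tall : ℕ → ℕ → Set
Tall n k = Σ (Adjacency n) λ G → IsSimple G × NumSpanningTrees G k

Tpla : ℕ → ℕ → Set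
Tpla n k = Σ (Adjacency n) λ G → IsSimple G × IsPlanar G × NumSpanningTrees G k

AtLeast : (ℕ → Set) → ℕ → Set
AtLeast S N = Σ (Fin N → ℕ) λ f → Injective _≡_ _≡_ f × (∀ i → S (f i))

-- The bound 0.9·cⁿ ≤ N with c = √(√2+1).
-- Write (1+√2)ⁿ = a n + b n · √2 (a, b ∈ ℕ).  Since c^{2n} = (1+√2)ⁿ and N ≥ 0,
--   0.9 cⁿ ≤ N  ⟺  81·(a + b√2) ≤ 100·N²
--             ⟺  81·a ≤ 100·N²  and  2·(81·b)² ≤ (100·N² − 81·a)².

pellAB : ℕ → ℕ × ℕ
pellAB zero = 1 , 0
pellAB (suc n) with pellAB n
... | a , b = a + 2 * b , a + b

pellA : ℕ → ℕ
pellA n with pellAB n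
... | a , _ = a

pellB : ℕ → ℕ
pellB n with pellAB n
... | _ , b = b

NinetyPercentCPowLe : ℕ → ℕ → Set
NinetyPercentCPowLe n N =
  (81 * pellA n ≤ 100 * (N * N)) ×
  (2 * ((81 * pellB n) * (81 * pellB n))
     ≤ (100 * (N * N) ∸ 81 * pellA n) * (100 * (N * N) ∸ 81 * pellA n))

{-# OPTIONS --safe #-}
-- Join a hub h to some vertices of a caterpillar whose vertices are created one after
-- the other, and let (t , f) be the numbers of spanning trees and of spanning forests
-- with two components separating h from the current tip. Each new vertex transforms
-- this pair:  S: (t , t + f),  P: (2t + f , t + f),  W: (2t + f , 2f).
-- In words made of blocks S^j P W^k with j , k ≤ 2, the last block can be read off the
-- ratio t / f, so distinct words give distinct pairs (t , f). Both t and 2t + f are tree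
-- counts of planar graphs on n vertices, whence |T|² is at least the number of words.
-- The number of words grows like the root 2.46… of x⁵ = x⁴ + 2x³ + 3x² + 2x + 1, which
-- exceeds 22/9 and hence 1 + √2 < 29/12 < 22/9.
module Submission where

open import Defs
open import Data.Bool using (Bool; false)
open import Data.Empty using (⊥; ⊥-elim)
open import Data.Fin using (Fin; zero; suc; inject₁; fromℕ; toℕ; combine; #_; _≟_)
open import Data.Fin.Properties
  using (suc-injective; toℕ-injective; toℕ-fromℕ; toℕ≤pred[n]; toℕ<n; combine-injective; injective⇒≤)
open import Data.Fin.Subset using (Subset; _∈_; _⊆_; ⁅_⁆; _∪_) renaming (⊥ to ∅)
open import Data.Fin.Subset.Properties
  using (_∈?_; ∉⊥; x∈⁅x⁆; x∈⁅y⁆⇒x≡y; x∈p∪q⁻; x∈p∪q⁺; ⊆-antisym)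
import Data.Integer as ℤ
import Data.Integer.Properties as ℤ
open import Data.List using (List; []; _∷_; length; _++_; map; replicate; deduplicate)
  renaming (lookup to lookupᴸ)
open import Data.List.Properties using (length-++; length-map; ∷-injectiveʳ)
open import Data.List.Membership.Propositional using () renaming (_∈_ to _∈ᴸ_)
open import Data.List.Membership.Propositional.Properties
  using (∈-lookup; ∈-++⁺ˡ; ∈-++⁺ʳ; ∈-++⁻; ∈-map⁺; ∈-map⁻; ∈-deduplicate⁺; ∈-deduplicate⁻)
open import Data.List.Membership.DecPropositional using () renaming (_∈?_ to member?)
import Data.List.Membership.Setoid.Properties as SetoidMembership
open import Data.List.Relation.Unary.All using (All; []; _∷_)
import Data.List.Relation.Unary.All as All
import Data.List.Relation.Unary.All.Properties as All
open import Data.List.Relation.Unary.AllPairs using ([]; _∷_)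
open import Data.List.Relation.Unary.Any using (here; there; index)
open import Data.List.Relation.Unary.Unique.Propositional using (Unique)
import Data.List.Relation.Unary.Unique.Propositional.Properties as Unique
import Data.List.Relation.Unary.Unique.DecPropositional as DecUnique
import Data.List.Relation.Unary.Unique.DecPropositional.Properties as DecUnique
open import Data.Nat
  using (ℕ; zero; suc; _+_; _*_; _∸_; _^_; _≤_; _<_; _≥_; z≤n; s≤s; >-nonZero)
open import Data.Nat.ListAction using (sum)
open import Data.Nat.Properties as ℕ hiding (_≟_; suc-injective)
open import Data.Nat.Tactic.RingSolver using (solve-∀)
open import Data.Product using (Σ; ∃; _×_; _,_; proj₁; proj₂)
open import Data.Product.Properties using (≡-dec)
open import Data.Sum using (_⊎_; inj₁; inj₂; [_,_]′)
import Data.Sum as Sum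
open import Data.Unit using (tt)
open import Data.Vec using (Vec; []; _∷_; lookup; zipWith; tail)
import Data.Vec as Vec
open import Data.Vec.Properties using (lookup-zipWith; lookup⇒[]=; []=⇒lookup; ∷-injective)
open import Function using (_∘_; id; case_of_)
open import Function.Bundles using (mk⇔; Equivalence)
open import Function.Definitions using (Injective)
open import Level using (0ℓ)
open import Relation.Binary using (Rel; Symmetric; _⇒_; DecidableEquality; tri<; tri≈; tri>)
open import Relation.Binary.Construct.Closure.ReflexiveTransitive
  using (Star; ε; _◅_; _◅◅_; gmap; kleisliStar; reverse)
open import Relation.Binary.PropositionalEquality
  using (_≡_; _≢_; refl; sym; trans; cong; cong₂; subst; subst₂; setoid; ≢-sym)
open import Relation.Nullary using (¬_; yes; no; contradiction)
open import Relation.Nullary.Decidable using (from-yes)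

open Equivalence using (to; from)
open ℕ.≤-Reasoning

-- Trees as connected graphs all of whose edges are bridges

-- Put r = t / f. Then S acts as 1/r ↦ 1/r + 1, W as r ↦ r + 1/2, and P as S followed by r ↦ r + 1.
-- From r in [1 , 3) a block S^j P W^k therefore leads into 1 + k/2 + [1/(j+2) , 3/(3j+4)). For j ,
-- k ≤ 2 these nine intervals are pairwise disjoint and stay inside (1 , 3), so blocks can be peeled
-- off one by one down to the empty word, where r = 1. Neither cap can be raised in this argument: j
-- = 3, k = 1 would reach down to 17/10, inside the interval [3/2 , 7/4) of j = k = 0, and k = 3
-- would leave [1 , 3) already for j = 0. A single count cannot serve as the code of a word, since S
-- does not change t. Coding by two counts costs a square root, so the number of words has to be
-- compared with the powers of c² = 1 + √2. The rational bounds 22/9 and 29/12 differ by the factor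
-- 88/87 per vertex, which in the long run absorbs every constant lost on the way.

Edges : Set → Set₁
Edges V = Rel V 0ℓ

Delete : ∀ {V} → Edges V → V → V → Edges V
Delete R a b x y = R x y × ¬ (x ≡ a × y ≡ b) × ¬ (x ≡ b × y ≡ a)

Link : ∀ {V} → V → V → Edges V
Link u v x y = (x ≡ u × y ≡ v) ⊎ (x ≡ v × y ≡ u)

AddEdge : ∀ {V} → Edges V → V → V → Edges V
AddEdge R u v x y = R x y ⊎ Link u v x y

-- Acyclicity is phrased through walks because maps of vertices, contractions in particular, carry
-- walks to walks, whereas they destroy the injectivity that a cycle requires.
TreeRel : ∀ {V} → Edges V → Set
TreeRel R = (∀ x y → Star R x y) × (∀ {x y} → R x y → ¬ Star (Delete R x y) x y)

TreeRel-resp : ∀ {V} {R T : Edges V} → R ⇒ T → T ⇒ R → TreeRel R → TreeRel T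
TreeRel-resp f g (con , bridge) =
  (λ x y → gmap id f (con x y)) ,
  (λ e p → bridge (g e) (gmap id (λ (q , a , b) → g q , a , b) p))

Delete-reverse : ∀ {V} {R : Edges V} → Symmetric R → ∀ {x y} →
  Star (Delete R x y) x y → Star (Delete R y x) y x
Delete-reverse s p = reverse (λ (q , a , b) → s q , (λ (c , d) → b (d , c)) , (λ (c , d) → a (d , c)))
  (gmap id (λ (q , a , b) → q , b , a) p)

AddEdge-sym : ∀ {V} {R : Edges V} {u v} → Symmetric R → Symmetric (AddEdge R u v)
AddEdge-sym s (inj₁ e) = inj₁ (s e)
AddEdge-sym s (inj₂ (inj₁ (a , b))) = inj₂ (inj₂ (b , a))
AddEdge-sym s (inj₂ (inj₂ (a , b))) = inj₂ (inj₁ (b , a))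

AddEdge-comm : ∀ {V} {R : Edges V} {u v} → AddEdge R u v ⇒ AddEdge R v u
AddEdge-comm (inj₁ e) = inj₁ e
AddEdge-comm (inj₂ (inj₁ e)) = inj₂ (inj₂ e)
AddEdge-comm (inj₂ (inj₂ e)) = inj₂ (inj₁ e)

Extend : ∀ {n} → (Fin n → Set) → Edges (Fin n) → Edges (Fin (suc n))
Extend N R zero zero = ⊥
Extend N R zero (suc j) = N j
Extend N R (suc i) zero = N i
Extend N R (suc i) (suc j) = R i j

Extend-sym : ∀ {n} {N : Fin n → Set} {R : Edges (Fin n)} → Symmetric R → Symmetric (Extend N R)
Extend-sym s {zero} {suc j} e = e
Extend-sym s {suc i} {zero} e = e
Extend-sym s {suc i} {suc j} e = s e

-- The new vertex is absorbed into `u`, so its edge to `u` becomes an empty walk. Walks of an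
-- extended graph are transferred to the old one by this map.
contract : ∀ {n} → Fin n → Fin (suc n) → Fin n
contract u zero = u
contract u (suc i) = i

bypass-suc : ∀ {n} {N : Fin n → Set} {R : Edges (Fin n)} {i j} →
  Star (Delete R i j) i j → Star (Delete (Extend N R) (suc i) (suc j)) (suc i) (suc j)
bypass-suc = gmap suc λ (e , a , b) →
  e , (λ (p , q) → a (suc-injective p , suc-injective q)) ,
      (λ (p , q) → b (suc-injective p , suc-injective q))

module _ {n} {N : Fin n → Set} {R : Edges (Fin n)} where

  isolated-¬tree : Fin n → (∀ j → ¬ N j) → ¬ TreeRel (Extend N R)
  isolated-¬tree j none (con , _) with con zero (suc j)
  ... | _◅_ {j = suc k} e _ = none k e

  module _ {u} (Nu : N u) (only : ∀ {j} → N j → j ≡ u) where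

    private
      -- `D` stands for the extended graph or for that graph without one old edge, so the same
      -- contraction serves connectivity and bridges.
      squash : ∀ {T : Edges (Fin n)} {D : Edges (Fin (suc n))} →
        (∀ x y → D x y → Extend N R x y) → (∀ {i j} → D (suc i) (suc j) → T i j) →
        ∀ x y → D x y → Star T (contract u x) (contract u y)
      squash f g zero zero e = ε
      squash f g zero (suc j) e with refl ← only (f _ _ e) = ε
      squash f g (suc i) zero e with refl ← only (f _ _ e) = ε
      squash f g (suc i) (suc j) e = g e ◅ ε

    leaf⁻ : TreeRel (Extend N R) → TreeRel R
    leaf⁻ (con , bridge) =
      (λ x y → kleisliStar (contract u) (λ {x} {y} → squash (λ _ _ q → q) id x y) (con (suc x) (suc y))) ,
      (λ e p → bridge {suc _} {suc _} e (bypass-suc p))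

    leaf⁺ : Symmetric R → TreeRel R → TreeRel (Extend N R)
    leaf⁺ s (con , bridge) = con′ , bridge′
      where
      con′ : ∀ x y → Star (Extend N R) x y
      con′ zero zero = ε
      con′ zero (suc y) = _◅_ {j = suc u} Nu (gmap suc id (con u y))
      con′ (suc x) zero = gmap suc id (con x u) ◅◅ (Nu ◅ ε)
      con′ (suc x) (suc y) = gmap suc id (con x y)

      pendant : ∀ {j} → N j → ¬ Star (Delete (Extend N R) zero (suc j)) zero (suc j)
      pendant Nj (_◅_ {j = suc k} (e , a , _) _) = a (refl , cong suc (trans (only e) (sym (only Nj))))

      bridge′ : ∀ {x y} → Extend N R x y → ¬ Star (Delete (Extend N R) x y) x y
      bridge′ {zero} {suc j} e p = pendant e p
      bridge′ {suc i} {zero} e p = pendant e (Delete-reverse {R = Extend N R} (λ {x} {y} → Extend-sym {R = R} s {x} {y}) p)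
      bridge′ {suc i} {suc j} e p = bridge e
        (kleisliStar (contract u)
          (λ {x} {y} → squash {D = Delete (Extend N R) (suc i) (suc j)} (λ _ _ → proj₁)
            (λ (q , a , b) → q , (λ (c , d) → a (cong suc c , cong suc d))
                               , (λ (c , d) → b (cong suc c , cong suc d))) x y) p)

  module _ {u v} (Nu : N u) (Nv : N v) (u≢v : u ≢ v) where

    triangle-¬tree : R u v → ¬ TreeRel (Extend N R)
    triangle-¬tree e (_ , bridge) = bridge {zero} {suc v} Nv
      (_◅_ {j = suc u} (Nu , (λ (_ , q) → u≢v (suc-injective q)) , λ ())
        ((e , (λ ()) , λ ()) ◅ ε))

  module _ {u v} (only : ∀ {j} → N j → j ≡ u ⊎ j ≡ v) (s : Symmetric R) (¬e : ¬ R u v) where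

    -- A cycle through the new vertex enters it from v and leaves it to u;
    -- contracting the edge to v turns it into a cycle through the edge u v.
    bypass-new : TreeRel (AddEdge R u v) → N u →
      ¬ Star (Delete (Extend N R) zero (suc u)) zero (suc u)
    bypass-new (_ , bridge) Nu (_◅_ {j = suc k} (e , a , _) p) with only e
    ... | inj₁ refl = a (refl , refl)
    ... | inj₂ refl = bridge (inj₂ (inj₂ (refl , refl))) (kleisliStar (contract v) step′ p)
      where
      step′ : ∀ {x y} → Delete (Extend N R) zero (suc u) x y →
        Star (Delete (AddEdge R u v) v u) (contract v x) (contract v y)
      step′ {zero} {suc j} (q , b , c) with only q
      ... | inj₁ refl = ⊥-elim (b (refl , refl))
      ... | inj₂ refl = ε
      step′ {suc i} {zero} (q , b , c) with only q
      ... | inj₁ refl = ⊥-elim (c (refl , refl))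
      ... | inj₂ refl = ε
      step′ {suc i} {suc j} (q , b , c) =
        (inj₁ q , (λ { (refl , refl) → ¬e (s q) }) , (λ { (refl , refl) → ¬e q })) ◅ ε

  module _ {u v} (Nu : N u) (Nv : N v) (only : ∀ {j} → N j → j ≡ u ⊎ j ≡ v)
           (u≢v : u ≢ v) (s : Symmetric R) (¬e : ¬ R u v) where

    private
      project : ∀ {T : Edges (Fin n)} {D : Edges (Fin (suc n))} →
        (∀ x y → D x y → Extend N R x y) → Link u v ⇒ T → (∀ {i j} → D (suc i) (suc j) → T i j) →
        ∀ x y → D x y → Star T (contract u x) (contract u y)
      project f l g zero zero e = ε
      project f l g zero (suc j) e with only (f _ _ e)
      ... | inj₁ refl = ε
      ... | inj₂ refl = l (inj₁ (refl , refl)) ◅ ε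
      project f l g (suc i) zero e with only (f _ _ e)
      ... | inj₁ refl = ε
      ... | inj₂ refl = l (inj₂ (refl , refl)) ◅ ε
      project f l g (suc i) (suc j) e = g e ◅ ε

      lift : ∀ {D : Edges (Fin (suc n))} {T : Edges (Fin n)} →
        (∀ {j} → N j → D zero (suc j)) → (∀ {j} → N j → D (suc j) zero) →
        (∀ {i j} → T i j → R i j → D (suc i) (suc j)) →
        T ⇒ AddEdge R u v → ∀ {x y} → T x y → Star D (suc x) (suc y)
      lift f g h k e with k e
      ... | inj₁ q = h e q ◅ ε
      ... | inj₂ (inj₁ (refl , refl)) = g Nu ◅ f Nv ◅ ε
      ... | inj₂ (inj₂ (refl , refl)) = g Nv ◅ f Nu ◅ ε

    -- A new vertex of degree two subdivides a virtual edge `u v`. The assumption `¬ R u v` matters: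
    -- an edge already present would merge with the virtual one in `AddEdge`, hiding the triangle
    -- that it forms with the new vertex.
    subdivide⁻ : TreeRel (Extend N R) → TreeRel (AddEdge R u v)
    subdivide⁻ (con , bridge) =
      (λ x y → kleisliStar (contract u) (λ {x} {y} → project (λ _ _ q → q) inj₂ inj₁ x y) (con (suc x) (suc y))) , bridge′
      where
      around : ¬ Star (Delete (AddEdge R u v) u v) u v
      -- The step from the new vertex to `u`, followed by the detour from `u` to `v`, bypasses the
      -- edge from the new vertex to `v`.
      around p = bridge {zero} {suc v} Nv
        (_◅_ {j = suc u} (Nu , (λ (_ , q) → u≢v (suc-injective q)) , λ ())
          (gmap suc only-old p))
        where
        only-old : ∀ {x y} → Delete (AddEdge R u v) u v x y →
          Delete (Extend N R) zero (suc v) (suc x) (suc y)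
        only-old (inj₁ q , _) = q , (λ ()) , λ ()
        only-old (inj₂ (inj₁ q) , a , _) = ⊥-elim (a q)
        only-old (inj₂ (inj₂ q) , _ , b) = ⊥-elim (b q)

      bridge′ : ∀ {x y} → AddEdge R u v x y → ¬ Star (Delete (AddEdge R u v) x y) x y
      bridge′ {x} {y} (inj₁ e) p = bridge {suc x} {suc y} e
        (kleisliStar suc
          (lift {T = Delete (AddEdge R u v) x y} (λ m → m , (λ ()) , λ ()) (λ m → m , (λ ()) , λ ())
            (λ (_ , a , b) q → q , (λ (c , d) → a (suc-injective c , suc-injective d))
                                 , (λ (c , d) → b (suc-injective c , suc-injective d)))
            proj₁) p)
      bridge′ (inj₂ (inj₁ (refl , refl))) p = around p
      bridge′ (inj₂ (inj₂ (refl , refl))) p = around (Delete-reverse {R = AddEdge R u v} (AddEdge-sym {R = R} s) p)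

    subdivide⁺ : TreeRel (AddEdge R u v) → TreeRel (Extend N R)
    subdivide⁺ t@(con , bridge) = con′ , bridge′
      where
      con″ : ∀ x y → Star (Extend N R) (suc x) (suc y)
      con″ x y = kleisliStar suc (lift id id (λ _ q → q) id) (con x y)

      con′ : ∀ x y → Star (Extend N R) x y
      con′ zero zero = ε
      con′ zero (suc y) = _◅_ {j = suc u} Nu (con″ u y)
      con′ (suc x) zero = con″ x u ◅◅ (Nu ◅ ε)
      con′ (suc x) (suc y) = con″ x y

      swap : ∀ {j} → N j → j ≡ v ⊎ j ≡ u
      swap m with only m
      ... | inj₁ e = inj₂ e
      ... | inj₂ e = inj₁ e

      new : ∀ {j} → N j → ¬ Star (Delete (Extend N R) zero (suc j)) zero (suc j)
      new m with only m
      ... | inj₁ refl = bypass-new only s ¬e t m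
      ... | inj₂ refl = bypass-new swap s (¬e ∘ s) (TreeRel-resp {R = AddEdge R u v} (AddEdge-comm {R = R}) (AddEdge-comm {R = R}) t) m

      bridge′ : ∀ {x y} → Extend N R x y → ¬ Star (Delete (Extend N R) x y) x y
      bridge′ {zero} {suc j} e p = new e p
      bridge′ {suc i} {zero} e p = new e (Delete-reverse {R = Extend N R} (λ {x} {y} → Extend-sym {R = R} s {x} {y}) p)
      bridge′ {suc i} {suc j} e p = bridge (inj₁ e)
        (kleisliStar (contract u)
          (λ {x} {y} → project {D = Delete (Extend N R) (suc i) (suc j)} (λ _ _ → proj₁)
            (λ l → inj₂ l , (λ { (refl , refl) → unlinked e l }) , (λ { (refl , refl) → unlinked (s e) l }))
            (λ (q , a , b) → inj₁ q , (λ (c , d) → a (cong suc c , cong suc d))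
                                    , (λ (c , d) → b (cong suc c , cong suc d))) x y) p)
        where
        unlinked : ∀ {i j} → R i j → ¬ Link u v i j
        unlinked q (inj₁ (refl , refl)) = ¬e q
        unlinked q (inj₂ (refl , refl)) = ¬e (s q)

-- Agreement with trees defined by injective cycles

lookup-injective : ∀ {A : Set} {xs : List A} → Unique xs → Injective _≡_ _≡_ (lookupᴸ xs)
lookup-injective (x∉ ∷ u) {zero} {zero} _ = refl
lookup-injective {xs = _ ∷ xs} (x∉ ∷ u) {zero} {suc j} e = contradiction e (All.lookup x∉ (∈-lookup j))
lookup-injective {xs = _ ∷ xs} (x∉ ∷ u) {suc i} {zero} e = contradiction (sym e) (All.lookup x∉ (∈-lookup i))
lookup-injective (x∉ ∷ u) {suc i} {suc j} e = cong suc (lookup-injective u e)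

data Trail {V : Set} (R : Edges V) : V → V → List V → Set where
  [_] : ∀ x → Trail R x x (x ∷ [])
  _∷_ : ∀ {x y z xs} → R x y → Trail R y z xs → Trail R x z (x ∷ xs)

module _ {V : Set} {R : Edges V} where

  trail-suffix : ∀ {x y z xs} → x ∈ᴸ xs → Trail R y z xs → Unique xs →
    ∃ λ ys → Trail R x z ys × Unique ys
  trail-suffix (here refl) [ _ ] u = _ , [ _ ] , u
  trail-suffix (here refl) (e ∷ t) u = _ , e ∷ t , u
  trail-suffix (there x∈) (e ∷ t) (_ ∷ u) = trail-suffix x∈ t u

  -- Loop erasure from the far end: if the start already occurs on the simple trail found for the
  -- rest of the walk, only the suffix from that occurrence is kept.
  simple-trail : DecidableEquality V → ∀ {x y} → Star R x y → ∃ λ xs → Trail R x y xs × Unique xs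
  simple-trail _≟_ ε = _ , [ _ ] , ([] ∷ [])
  simple-trail _≟_ {x} (e ◅ p) with xs , t , u ← simple-trail _≟_ p | member? _≟_ x xs
  ... | yes x∈ = trail-suffix x∈ t u
  ... | no x∉ = _ , e ∷ t , (All.¬Any⇒All¬ _ x∉ ∷ u)

  trail-head : ∀ {x y z zs} → Trail R x y (z ∷ zs) → z ≡ x
  trail-head [ _ ] = refl
  trail-head (_ ∷ _) = refl

  trail-last : ∀ {x y z zs} → Trail R x y (z ∷ zs) → lookupᴸ (z ∷ zs) (fromℕ (length zs)) ≡ y
  trail-last [ _ ] = refl
  trail-last (_ ∷ [ _ ]) = refl
  trail-last (_ ∷ t@(_ ∷ _)) = trail-last t

  trail-step : ∀ {x y z zs} → Trail R x y (z ∷ zs) → ∀ i →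
    R (lookupᴸ (z ∷ zs) (inject₁ i)) (lookupᴸ (z ∷ zs) (suc i))
  trail-step (e ∷ [ _ ]) zero = e
  trail-step (e ∷ (_ ∷ _)) zero = e
  trail-step (_ ∷ t@(_ ∷ _)) (suc i) = trail-step t i

  star-along : ∀ m (w : Fin (suc m) → V) → (∀ i → R (w (inject₁ i)) (w (suc i))) →
    Star R (w zero) (w (fromℕ m))
  star-along zero w f = ε
  star-along (suc m) w f = f zero ◅ star-along m (w ∘ suc) (f ∘ suc)

Adj-symmetric : ∀ {n} (A : Adjacency n) → IsSimple A → Symmetric (Adj A)
Adj-symmetric A simple {i} {j} e = trans (sym (proj₁ simple i j)) e

module _ {n} {A : Adjacency n} where

  walk⇒star : ∀ {i j} → Walk A i j → Star (Adj A) i j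
  walk⇒star here = ε
  walk⇒star (step e w) = e ◅ walk⇒star w

  star⇒walk : ∀ {i j} → Star (Adj A) i j → Walk A i j
  star⇒walk ε = here
  star⇒walk (e ◅ p) = step e (star⇒walk p)

  module _ (simple : IsSimple A) where

    private
      Adj-sym : Symmetric (Adj A)
      Adj-sym = Adj-symmetric A simple

    Adj-irrefl : ∀ {i} → ¬ Adj A i i
    Adj-irrefl {i} e with () ← trans (sym e) (proj₂ simple i)

    long-trail⇒cycle : ∀ {i j x y z zs} → Adj A i j →
      Trail (Delete (Adj A) i j) i j (x ∷ y ∷ z ∷ zs) → Unique (x ∷ y ∷ z ∷ zs) → HasCycle A
    long-trail⇒cycle {j = j} {zs = zs} e t u =
      length zs , lookupᴸ (_ ∷ _ ∷ _ ∷ zs) , lookup-injective u , proj₁ ∘ trail-step t ,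
      subst (λ l → Adj A l _) (sym (trail-last t)) (subst (Adj A j) (sym (trail-head t)) (Adj-sym e))

    -- A simple trail around the edge closes up to a cycle once it has three vertices. With one
    -- vertex the edge would be a loop, and with two the trail would use the deleted edge itself.
    bypass⇒cycle : ∀ {i j} → Adj A i j → Star (Delete (Adj A) i j) i j → HasCycle A
    bypass⇒cycle e p with simple-trail _≟_ p
    ... | _ , [ _ ] , _ = contradiction e Adj-irrefl
    ... | _ , ((_ , a , _) ∷ [ _ ]) , _ = contradiction (refl , refl) a
    ... | _ , t@(_ ∷ (_ ∷ [ _ ])) , u = long-trail⇒cycle e t u
    ... | _ , t@(_ ∷ (_ ∷ (_ ∷ _))) , u = long-trail⇒cycle e t u

    IsTree⇒TreeRel : IsTree A → TreeRel (Adj A)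
    IsTree⇒TreeRel (con , acyclic) =
      (λ x y → walk⇒star (con x y)) , (λ e p → acyclic (bypass⇒cycle e p))

    TreeRel⇒IsTree : TreeRel (Adj A) → IsTree A
    TreeRel⇒IsTree (con , bridge) = (λ i j → star⇒walk (con i j)) , acyclic
      where
      acyclic : ¬ HasCycle A
      acyclic (k , v , inj , f , e) = bridge (Adj-sym e) (star-along (2 + k) v avoid)
        where
        avoid : ∀ i → Delete (Adj A) (v zero) (v (fromℕ (2 + k))) (v (inject₁ i)) (v (suc i))
        -- Here the length of at least three enters: `suc zero` differs from `fromℕ (2 + k)`, so the
        -- first edge is not the closing one.
        avoid zero = f zero , (λ (_ , q) → case inj q of λ ()) , (λ (_ , q) → case inj q of λ ())
        avoid (suc i) = f (suc i) , (λ (q , _) → case inj q of λ ()) , (λ (_ , q) → case inj q of λ ())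

-- Counting spanning trees by their restriction to the older vertices

HasCount-resp : ∀ {A : Set} {P Q : A → Set} {k} → (∀ {x} → P x → Q x) → (∀ {x} → Q x → P x) →
  HasCount P k → HasCount Q k
HasCount-resp f g (xs , len , u , mem) = xs , len , u , λ x → mk⇔ (f ∘ to (mem x)) (from (mem x) ∘ g)

HasCount-⊎ : ∀ {A : Set} {P Q : A → Set} {k l} → (∀ {x} → P x → ¬ Q x) →
  HasCount P k → HasCount Q l → HasCount (λ x → P x ⊎ Q x) (k + l)
HasCount-⊎ disjoint (xs , refl , u , mem) (ys , refl , u′ , mem′) =
  xs ++ ys , length-++ xs ,
  Unique.++⁺ u u′ (λ (x∈ , y∈) → disjoint (to (mem _) x∈) (to (mem′ _) y∈)) ,
  λ x → mk⇔ (Sum.map (to (mem x)) (to (mem′ x)) ∘ ∈-++⁻ xs)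
            [ ∈-++⁺ˡ ∘ from (mem x) , ∈-++⁺ʳ xs ∘ from (mem′ x) ]′

HasCount-image : ∀ {A B : Set} {P : A → Set} {k} {f : A → B} → Injective _≡_ _≡_ f →
  HasCount P k → HasCount (λ y → ∃ λ x → y ≡ f x × P x) k
HasCount-image {f = f} inj (xs , refl , u , mem) =
  map f xs , length-map f xs , Unique.map⁺ inj u ,
  λ y → mk⇔ (λ y∈ → let x , x∈ , e = ∈-map⁻ f y∈ in x , e , to (mem x) x∈)
            (λ { (x , refl , p) → ∈-map⁺ f (from (mem x) p) })

extend : ∀ {n} → Subset n → Adjacency n → Adjacency (suc n)
extend r A = (false ∷ r) ∷ zipWith _∷_ r A

lookup-extend : ∀ {n} (r : Subset n) (A : Adjacency n) i →
  lookup (extend r A) (suc i) ≡ lookup r i ∷ lookup A i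
lookup-extend r A i = lookup-zipWith _∷_ i r A

module _ {n} {r : Subset n} {A : Adjacency n} where

  Adj-extend⁻ : ∀ i j → Adj (extend r A) i j → Extend (_∈ r) (Adj A) i j
  Adj-extend⁻ zero (suc j) e = lookup⇒[]= j r e
  Adj-extend⁻ (suc i) zero e rewrite lookup-extend r A i = lookup⇒[]= i r e
  Adj-extend⁻ (suc i) (suc j) e rewrite lookup-extend r A i = e

  Adj-extend⁺ : ∀ i j → Extend (_∈ r) (Adj A) i j → Adj (extend r A) i j
  Adj-extend⁺ zero (suc j) e = []=⇒lookup e
  Adj-extend⁺ (suc i) zero e rewrite lookup-extend r A i = []=⇒lookup e
  Adj-extend⁺ (suc i) (suc j) e rewrite lookup-extend r A i = e

  IsSimple-extend⁺ : IsSimple A → IsSimple (extend r A)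
  IsSimple-extend⁺ (s , d) = s′ , d′
    where
    s′ : ∀ i j → lookup (lookup (extend r A) i) j ≡ lookup (lookup (extend r A) j) i
    s′ zero zero = refl
    s′ zero (suc j) rewrite lookup-extend r A j = refl
    s′ (suc i) zero rewrite lookup-extend r A i = refl
    s′ (suc i) (suc j) rewrite lookup-extend r A i | lookup-extend r A j = s i j
    d′ : ∀ i → lookup (lookup (extend r A) i) i ≡ false
    d′ zero = refl
    d′ (suc i) rewrite lookup-extend r A i = d i

  IsSimple-extend⁻ : IsSimple (extend r A) → IsSimple A
  IsSimple-extend⁻ (s , d) =
    (λ i j → trans (sym (old i j)) (trans (s (suc i) (suc j)) (old j i))) ,
    (λ i → trans (sym (old i i)) (d (suc i)))
    where
    old : ∀ i j → lookup (lookup (extend r A) (suc i)) (suc j) ≡ lookup (lookup A i) j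
    old i j = cong (λ v → lookup v (suc j)) (lookup-extend r A i)

-- Simplicity determines exactly the entries that `extend` fills in by itself: the corner is
-- `false`, and the first column repeats the first row.
unextend : ∀ {n} (X : Adjacency (suc n)) → IsSimple X → ∃ λ r → ∃ λ A → X ≡ extend r A
unextend ((d ∷ r) ∷ rows) (s , diag) = r , Vec.map tail rows ,
  cong₂ _∷_ (cong (_∷ r) (diag zero)) (reassemble rows r (λ i → s (suc i) zero))
  where
  reassemble : ∀ {m k} (rows : Vec (Vec Bool (suc k)) m) (r : Vec Bool m) →
    (∀ i → lookup (lookup rows i) zero ≡ lookup r i) → rows ≡ zipWith _∷_ r (Vec.map tail rows)
  reassemble [] [] _ = refl
  reassemble ((x ∷ row) ∷ rows) (y ∷ r) f =
    cong₂ _∷_ (cong (_∷ row) (f zero)) (reassemble rows r (f ∘ suc))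

extend-injectiveˡ : ∀ {n} {r s : Subset n} {A B : Adjacency n} → extend r A ≡ extend s B → r ≡ s
extend-injectiveˡ e = proj₂ (∷-injective (proj₁ (∷-injective e)))

extend-injectiveʳ : ∀ {n} {r s : Subset n} {A B : Adjacency n} → extend r A ≡ extend s B → A ≡ B
extend-injectiveʳ {r = r} {s} {A} {B} e = rows r s A B (proj₂ (∷-injective e))
  where
  rows : ∀ {m k} (r s : Vec Bool m) (A B : Vec (Vec Bool k) m) →
    zipWith Vec._∷_ r A ≡ zipWith Vec._∷_ s B → A ≡ B
  rows [] [] [] [] _ = refl
  rows (_ ∷ r) (_ ∷ s) (_ ∷ A) (_ ∷ B) e with e₁ , e₂ ← ∷-injective e =
    cong₂ _∷_ (proj₂ (∷-injective e₁)) (rows r s A B e₂)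

-- Spanning trees and separating forests under the addition of a vertex

SpanningTree : ∀ {n} → Adjacency n → Adjacency n → Set
SpanningTree G X = IsSimple X × (X ⊆ᴳ G) × TreeRel (Adj X)

-- Two-component spanning forests separating u from v, described through the
-- spanning trees they become once the edge u v is added.
Separating : ∀ {n} → Adjacency n → Fin n → Fin n → Adjacency n → Set
Separating G u v X = IsSimple X × (X ⊆ᴳ G) × ¬ Adj X u v × TreeRel (AddEdge (Adj X) u v)

module _ {n} {ρ : Subset n} {G : Adjacency n} where

  ⊆ᴳ-extend⁺ : ∀ {r A} → r ⊆ ρ → A ⊆ᴳ G → extend r A ⊆ᴳ extend ρ G
  ⊆ᴳ-extend⁺ {r} {A} r⊆ A⊆ i j e = Adj-extend⁺ i j (include i j (Adj-extend⁻ {r = r} {A} i j e))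
    where
    include : ∀ i j → Extend (_∈ r) (Adj A) i j → Extend (_∈ ρ) (Adj G) i j
    include zero (suc j) = r⊆
    include (suc i) zero = r⊆
    include (suc i) (suc j) = A⊆ i j

  ⊆ᴳ-extend⁻ : ∀ {r A} → extend r A ⊆ᴳ extend ρ G → r ⊆ ρ × (A ⊆ᴳ G)
  ⊆ᴳ-extend⁻ {r} {A} sub =
    (λ {j} j∈ → Adj-extend⁻ {r = ρ} {G} zero (suc j) (sub zero (suc j) (Adj-extend⁺ {r = r} {A} zero (suc j) j∈))) ,
    (λ i j e → Adj-extend⁻ {r = ρ} {G} (suc i) (suc j) (sub (suc i) (suc j) (Adj-extend⁺ {r = r} {A} (suc i) (suc j) e)))

-- One class of the partition of subgraphs by the neighbourhood `r` of the new vertex. Each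
-- recurrence for the counts is a sum over such classes.
Slice : ∀ {n} → Subset n → (Adjacency n → Set) → Adjacency (suc n) → Set
Slice r Q X = ∃ λ A → X ≡ extend r A × Q A

HasCount-slice : ∀ {n} (r : Subset n) {Q : Adjacency n → Set} {k} → HasCount Q k → HasCount (Slice r Q) k
HasCount-slice r = HasCount-image extend-injectiveʳ

slices-disjoint : ∀ {n} {r s : Subset n} {P Q : Adjacency n → Set} {X} → r ≢ s → Slice r P X → ¬ Slice s Q X
slices-disjoint r≢s (_ , refl , _) (_ , e , _) = r≢s (extend-injectiveˡ e)

⊆⁅⁆-cases : ∀ {n} {r : Subset n} {u} → r ⊆ ⁅ u ⁆ → r ≡ ∅ ⊎ r ≡ ⁅ u ⁆
⊆⁅⁆-cases {r = r} {u} sub with u ∈? r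
... | yes u∈ = inj₂ (⊆-antisym sub (λ x∈ → subst (_∈ r) (sym (x∈⁅y⁆⇒x≡y u x∈)) u∈))
... | no u∉ = inj₁ (⊆-antisym (λ x∈ → contradiction (subst (_∈ r) (x∈⁅y⁆⇒x≡y u (sub x∈)) x∈) u∉)
                              (λ x∈ → contradiction x∈ ∉⊥))

pair⁻ : ∀ {n} {u v j : Fin n} → j ∈ ⁅ u ⁆ ∪ ⁅ v ⁆ → j ≡ u ⊎ j ≡ v
pair⁻ {u = u} {v} j∈ = Sum.map (x∈⁅y⁆⇒x≡y u) (x∈⁅y⁆⇒x≡y v) (x∈p∪q⁻ ⁅ u ⁆ ⁅ v ⁆ j∈)

left∈pair : ∀ {n} {u v : Fin n} → u ∈ ⁅ u ⁆ ∪ ⁅ v ⁆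
left∈pair {u = u} = x∈p∪q⁺ (inj₁ (x∈⁅x⁆ u))

right∈pair : ∀ {n} {u v : Fin n} → v ∈ ⁅ u ⁆ ∪ ⁅ v ⁆
right∈pair {v = v} = x∈p∪q⁺ (inj₂ (x∈⁅x⁆ v))

⁅⁆⊆ : ∀ {n} {p : Subset n} {u} → u ∈ p → ⁅ u ⁆ ⊆ p
⁅⁆⊆ {p = p} {u} u∈ x∈ = subst (_∈ p) (sym (x∈⁅y⁆⇒x≡y u x∈)) u∈

⊆pair-cases : ∀ {n} {r : Subset n} {u v} → r ⊆ ⁅ u ⁆ ∪ ⁅ v ⁆ →
  (r ≡ ∅ ⊎ r ≡ ⁅ u ⁆) ⊎ (r ≡ ⁅ v ⁆ ⊎ r ≡ ⁅ u ⁆ ∪ ⁅ v ⁆)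
⊆pair-cases {r = r} {u} {v} sub with v ∈? r
... | no v∉ = inj₁ (⊆⁅⁆-cases λ x∈ → case pair⁻ (sub x∈) of λ where
  (inj₁ refl) → x∈⁅x⁆ u
  (inj₂ refl) → contradiction x∈ v∉)
... | yes v∈ with u ∈? r
... | yes u∈ = inj₂ (inj₂ (⊆-antisym sub λ x∈ → case pair⁻ x∈ of λ where
  (inj₁ refl) → u∈
  (inj₂ refl) → v∈))
... | no u∉ = inj₂ (inj₁ (⊆-antisym (λ x∈ → case pair⁻ (sub x∈) of λ where
  (inj₁ refl) → contradiction x∈ u∉
  (inj₂ refl) → x∈⁅x⁆ v) (⁅⁆⊆ v∈)))

module _ {n} (A : Adjacency n) (simple : IsSimple A) where

  private
    R = Adj A
    s : Symmetric R
    s = Adj-symmetric A simple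

  module _ {r : Subset n} where

    tree-extend⁻ : TreeRel (Adj (extend r A)) → TreeRel (Extend (_∈ r) R)
    tree-extend⁻ = TreeRel-resp (λ {i} {j} → Adj-extend⁻ {r = r} {A} i j) (λ {i} {j} → Adj-extend⁺ {r = r} {A} i j)

    tree-extend⁺ : TreeRel (Extend (_∈ r) R) → TreeRel (Adj (extend r A))
    tree-extend⁺ = TreeRel-resp (λ {i} {j} → Adj-extend⁺ {r = r} {A} i j) (λ {i} {j} → Adj-extend⁻ {r = r} {A} i j)

    module _ {h : Fin n} where

      private
        out : ∀ {i j} → AddEdge (Adj (extend r A)) zero (suc h) i j → Extend (_∈ (r ∪ ⁅ h ⁆)) R i j
        out {i} {j} (inj₁ e) = widen i j (Adj-extend⁻ {r = r} {A} i j e)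
          where
          widen : ∀ i j → Extend (_∈ r) R i j → Extend (_∈ (r ∪ ⁅ h ⁆)) R i j
          widen zero (suc j) m = x∈p∪q⁺ (inj₁ m)
          widen (suc i) zero m = x∈p∪q⁺ (inj₁ m)
          widen (suc i) (suc j) m = m
        out (inj₂ (inj₁ (refl , refl))) = x∈p∪q⁺ (inj₂ (x∈⁅x⁆ h))
        out (inj₂ (inj₂ (refl , refl))) = x∈p∪q⁺ (inj₂ (x∈⁅x⁆ h))

        into : ∀ i j → Extend (_∈ (r ∪ ⁅ h ⁆)) R i j → AddEdge (Adj (extend r A)) zero (suc h) i j
        into zero (suc j) m with x∈p∪q⁻ r ⁅ h ⁆ m
        ... | inj₁ j∈r = inj₁ (Adj-extend⁺ {r = r} {A} zero (suc j) j∈r)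
        ... | inj₂ j∈h = inj₂ (inj₁ (refl , cong suc (x∈⁅y⁆⇒x≡y h j∈h)))
        into (suc i) zero m with x∈p∪q⁻ r ⁅ h ⁆ m
        ... | inj₁ j∈r = inj₁ (Adj-extend⁺ {r = r} {A} (suc i) zero j∈r)
        ... | inj₂ j∈h = inj₂ (inj₂ (cong suc (x∈⁅y⁆⇒x≡y h j∈h) , refl))
        into (suc i) (suc j) m = inj₁ (Adj-extend⁺ {r = r} {A} (suc i) (suc j) m)

      -- A virtual edge at the new vertex is just one more neighbour of it, so forests separating
      -- the new vertex from `h` are handled by the same leaf and subdivision lemmas as trees.
      tree-link⁻ : TreeRel (AddEdge (Adj (extend r A)) zero (suc h)) → TreeRel (Extend (_∈ (r ∪ ⁅ h ⁆)) R)
      tree-link⁻ = TreeRel-resp out (λ {i} {j} → into i j)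

      tree-link⁺ : TreeRel (Extend (_∈ (r ∪ ⁅ h ⁆)) R) → TreeRel (AddEdge (Adj (extend r A)) zero (suc h))
      tree-link⁺ = TreeRel-resp (λ {i} {j} → into i j) out

    module _ {u h : Fin n} where

      private
        out : ∀ i j → AddEdge (Adj (extend r A)) (suc u) (suc h) i j → Extend (_∈ r) (AddEdge R u h) i j
        out i j (inj₁ e) = widen i j (Adj-extend⁻ {r = r} {A} i j e)
          where
          widen : ∀ i j → Extend (_∈ r) R i j → Extend (_∈ r) (AddEdge R u h) i j
          widen zero (suc j) m = m
          widen (suc i) zero m = m
          widen (suc i) (suc j) m = inj₁ m
        out (suc i) (suc j) (inj₂ (inj₁ (refl , refl))) = inj₂ (inj₁ (refl , refl))
        out (suc i) (suc j) (inj₂ (inj₂ (refl , refl))) = inj₂ (inj₂ (refl , refl))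

        into : ∀ i j → Extend (_∈ r) (AddEdge R u h) i j → AddEdge (Adj (extend r A)) (suc u) (suc h) i j
        into zero (suc j) m = inj₁ (Adj-extend⁺ {r = r} {A} zero (suc j) m)
        into (suc i) zero m = inj₁ (Adj-extend⁺ {r = r} {A} (suc i) zero m)
        into (suc i) (suc j) (inj₁ m) = inj₁ (Adj-extend⁺ {r = r} {A} (suc i) (suc j) m)
        into (suc i) (suc j) (inj₂ (inj₁ (refl , refl))) = inj₂ (inj₁ (refl , refl))
        into (suc i) (suc j) (inj₂ (inj₂ (refl , refl))) = inj₂ (inj₂ (refl , refl))

      tree-sucs⁻ : TreeRel (AddEdge (Adj (extend r A)) (suc u) (suc h)) → TreeRel (Extend (_∈ r) (AddEdge R u h))
      tree-sucs⁻ = TreeRel-resp (λ {i} {j} → out i j) (λ {i} {j} → into i j)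

      tree-sucs⁺ : TreeRel (Extend (_∈ r) (AddEdge R u h)) → TreeRel (AddEdge (Adj (extend r A)) (suc u) (suc h))
      tree-sucs⁺ = TreeRel-resp (λ {i} {j} → into i j) (λ {i} {j} → out i j)

  -- This is where trees of the larger graph become separating forests of the smaller: the path
  -- through the new vertex takes the place of the virtual edge `u v`.
  pair-tree⁻ : ∀ {u v} → u ≢ v → TreeRel (Extend (_∈ (⁅ u ⁆ ∪ ⁅ v ⁆)) R) →
    ¬ R u v × TreeRel (AddEdge R u v)
  pair-tree⁻ u≢v t = ¬e , subdivide⁻ left∈pair right∈pair pair⁻ u≢v s ¬e t
    where
    ¬e : ¬ R _ _
    ¬e e = triangle-¬tree {R = R} left∈pair right∈pair u≢v e t

  pair-tree⁺ : ∀ {u v} → u ≢ v → ¬ R u v × TreeRel (AddEdge R u v) →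
    TreeRel (Extend (_∈ (⁅ u ⁆ ∪ ⁅ v ⁆)) R)
  pair-tree⁺ u≢v (¬e , t) = subdivide⁺ left∈pair right∈pair pair⁻ u≢v s ¬e t

singleton⁻ : ∀ {n} {u : Fin n} {R : Edges (Fin n)} → TreeRel (Extend (_∈ ⁅ u ⁆) R) → TreeRel R
singleton⁻ {u = u} = leaf⁻ (x∈⁅x⁆ u) (x∈⁅y⁆⇒x≡y u)

singleton⁺ : ∀ {n} {u : Fin n} {R : Edges (Fin n)} → Symmetric R → TreeRel R → TreeRel (Extend (_∈ ⁅ u ⁆) R)
singleton⁺ {u = u} = leaf⁺ (x∈⁅x⁆ u) (x∈⁅y⁆⇒x≡y u)

∅-¬tree : ∀ {n} {R : Edges (Fin n)} → Fin n → ¬ TreeRel (Extend (_∈ ∅) R)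
∅-¬tree u = isolated-¬tree u (λ j → ∉⊥)

module _ {n} {ρ : Subset n} {G : Adjacency n} where

  spanning-slice⁻ : ∀ {X} → SpanningTree (extend ρ G) X → ∃ λ r → ∃ λ A →
    X ≡ extend r A × r ⊆ ρ × IsSimple A × (A ⊆ᴳ G) × TreeRel (Extend (_∈ r) (Adj A))
  spanning-slice⁻ {X} (simple , sub , t) with r , A , refl ← unextend X simple =
    let simpleA = IsSimple-extend⁻ {r = r} simple; r⊆ , A⊆ = ⊆ᴳ-extend⁻ {ρ = ρ} {G} {r} sub
    in r , A , refl , r⊆ , simpleA , A⊆ , tree-extend⁻ A simpleA t

  spanning-slice⁺ : ∀ {r A} → r ⊆ ρ → IsSimple A → A ⊆ᴳ G → TreeRel (Extend (_∈ r) (Adj A)) →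
    SpanningTree (extend ρ G) (extend r A)
  spanning-slice⁺ {r} {A} r⊆ simple A⊆ t =
    IsSimple-extend⁺ simple , ⊆ᴳ-extend⁺ {ρ = ρ} {G} r⊆ A⊆ , tree-extend⁺ A simple t

  separating-slice⁻ : ∀ {u v X} → Separating (extend ρ G) u v X → ∃ λ r → ∃ λ A →
    X ≡ extend r A × r ⊆ ρ × IsSimple A × (A ⊆ᴳ G) ×
    ¬ Adj (extend r A) u v × TreeRel (AddEdge (Adj (extend r A)) u v)
  separating-slice⁻ {X = X} (simple , sub , ¬e , t) with r , A , refl ← unextend X simple =
    let simpleA = IsSimple-extend⁻ {r = r} simple; r⊆ , A⊆ = ⊆ᴳ-extend⁻ {ρ = ρ} {G} {r} sub
    in r , A , refl , r⊆ , simpleA , A⊆ , ¬e , t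

  separating-slice⁺ : ∀ {r A u v} → r ⊆ ρ → IsSimple A → A ⊆ᴳ G →
    ¬ Adj (extend r A) u v → TreeRel (AddEdge (Adj (extend r A)) u v) →
    Separating (extend ρ G) u v (extend r A)
  separating-slice⁺ {r} r⊆ simple A⊆ ¬e t =
    IsSimple-extend⁺ simple , ⊆ᴳ-extend⁺ {ρ = ρ} {G} r⊆ A⊆ , ¬e , t

⁅⁆-injective : ∀ {n} {u v : Fin n} → ⁅ u ⁆ ≡ ⁅ v ⁆ → u ≡ v
⁅⁆-injective {u = u} {v} e = x∈⁅y⁆⇒x≡y v (subst (u ∈_) e (x∈⁅x⁆ u))

module _ {n} {A : Adjacency n} (simple : IsSimple A) {h : Fin n} where

  private
    h∈ : h ∈ ∅ ∪ ⁅ h ⁆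
    h∈ = x∈p∪q⁺ (inj₂ (x∈⁅x⁆ h))

    only-h : ∀ {j} → j ∈ ∅ ∪ ⁅ h ⁆ → j ≡ h
    only-h j∈ = [ (λ j∈∅ → contradiction j∈∅ ∉⊥) , x∈⁅y⁆⇒x≡y h ]′ (x∈p∪q⁻ ∅ ⁅ h ⁆ j∈)

  link-∅⁺ : TreeRel (Adj A) → TreeRel (AddEdge (Adj (extend ∅ A)) zero (suc h))
  link-∅⁺ t = tree-link⁺ A simple (leaf⁺ h∈ only-h (Adj-symmetric A simple) t)

  link-∅⁻ : TreeRel (AddEdge (Adj (extend ∅ A)) zero (suc h)) → TreeRel (Adj A)
  link-∅⁻ t = leaf⁻ h∈ only-h (tree-link⁻ A simple t)

module _ {n} {G : Adjacency n} {u : Fin n} where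

  count-leaf : ∀ {t} → HasCount (SpanningTree G) t → HasCount (SpanningTree (extend ⁅ u ⁆ G)) t
  count-leaf c = HasCount-resp into out (HasCount-slice ⁅ u ⁆ c)
    where
    into : ∀ {X} → Slice ⁅ u ⁆ (SpanningTree G) X → SpanningTree (extend ⁅ u ⁆ G) X
    into (A , refl , simple , A⊆ , t) =
      spanning-slice⁺ id simple A⊆ (singleton⁺ (Adj-symmetric A simple) t)

    out : ∀ {X} → SpanningTree (extend ⁅ u ⁆ G) X → Slice ⁅ u ⁆ (SpanningTree G) X
    out {X} T with r , A , refl , r⊆ , simple , A⊆ , t ← spanning-slice⁻ {G = G} {X = X} T | ⊆⁅⁆-cases r⊆
    ... | inj₁ refl = contradiction t (∅-¬tree u)
    ... | inj₂ refl = A , refl , simple , A⊆ , singleton⁻ t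

  module _ {h : Fin n} (u≢h : u ≢ h) where

    private
      pair≢ˡ : ⁅ u ⁆ ≢ ⁅ u ⁆ ∪ ⁅ h ⁆
      pair≢ˡ e = u≢h (sym (x∈⁅y⁆⇒x≡y u (subst (h ∈_) (sym e) right∈pair)))

      pair≢ʳ : ⁅ h ⁆ ≢ ⁅ u ⁆ ∪ ⁅ h ⁆
      pair≢ʳ e = u≢h (x∈⁅y⁆⇒x≡y h (subst (u ∈_) (sym e) left∈pair))

      single≢ : ⁅ u ⁆ ≢ ⁅ h ⁆
      single≢ = u≢h ∘ ⁅⁆-injective

    -- The summands belong to the neighbourhoods `⁅ u ⁆`, `⁅ h ⁆` and `⁅ u ⁆ ∪ ⁅ h ⁆`. In the first
    -- two the new vertex is a leaf; in the third it joins the two components of a separating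
    -- forest.
    count-triangle : ∀ {t f} → HasCount (SpanningTree G) t → HasCount (Separating G u h) f →
      HasCount (SpanningTree (extend (⁅ u ⁆ ∪ ⁅ h ⁆) G)) (t + (t + f))
    count-triangle c d = HasCount-resp into out
      (HasCount-⊎ (λ p → [ slices-disjoint single≢ p , slices-disjoint pair≢ˡ p ]′)
        (HasCount-slice ⁅ u ⁆ c)
        (HasCount-⊎ (slices-disjoint pair≢ʳ) (HasCount-slice ⁅ h ⁆ c) (HasCount-slice (⁅ u ⁆ ∪ ⁅ h ⁆) d)))
      where
      leaf : ∀ {w X} → w ∈ ⁅ u ⁆ ∪ ⁅ h ⁆ → Slice ⁅ w ⁆ (SpanningTree G) X →
        SpanningTree (extend (⁅ u ⁆ ∪ ⁅ h ⁆) G) X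
      leaf w∈ (A , refl , simple , A⊆ , t) =
        spanning-slice⁺ (⁅⁆⊆ w∈) simple A⊆ (singleton⁺ (Adj-symmetric A simple) t)

      into : ∀ {X} → Slice ⁅ u ⁆ (SpanningTree G) X ⊎ Slice ⁅ h ⁆ (SpanningTree G) X ⊎
        Slice (⁅ u ⁆ ∪ ⁅ h ⁆) (Separating G u h) X → SpanningTree (extend (⁅ u ⁆ ∪ ⁅ h ⁆) G) X
      into (inj₁ p) = leaf left∈pair p
      into (inj₂ (inj₁ p)) = leaf right∈pair p
      into (inj₂ (inj₂ (A , refl , simple , A⊆ , t))) =
        spanning-slice⁺ id simple A⊆ (pair-tree⁺ A simple u≢h t)

      out : ∀ {X} → SpanningTree (extend (⁅ u ⁆ ∪ ⁅ h ⁆) G) X →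
        Slice ⁅ u ⁆ (SpanningTree G) X ⊎ Slice ⁅ h ⁆ (SpanningTree G) X ⊎
        Slice (⁅ u ⁆ ∪ ⁅ h ⁆) (Separating G u h) X
      out {X} T with r , A , refl , r⊆ , simple , A⊆ , t ← spanning-slice⁻ {G = G} {X = X} T | ⊆pair-cases r⊆
      ... | inj₁ (inj₁ refl) = contradiction t (∅-¬tree u)
      ... | inj₁ (inj₂ refl) = inj₁ (A , refl , simple , A⊆ , singleton⁻ t)
      ... | inj₂ (inj₁ refl) = inj₂ (inj₁ (A , refl , simple , A⊆ , singleton⁻ t))
      ... | inj₂ (inj₂ refl) = inj₂ (inj₂ (A , refl , simple , A⊆ , pair-tree⁻ A simple u≢h t))

    -- A forest separating the new vertex from `h` cannot use an edge between them, so S and P share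
    -- this count. With neighbourhood `∅` the new vertex hangs on the virtual edge alone and leaves
    -- a tree; with `⁅ u ⁆` it subdivides the virtual edge `u h`.
    count-separating-new : ∀ {ρ t f} → u ∈ ρ → ρ ⊆ ⁅ u ⁆ ∪ ⁅ h ⁆ →
      HasCount (SpanningTree G) t → HasCount (Separating G u h) f →
      HasCount (Separating (extend ρ G) zero (suc h)) (t + f)
    count-separating-new {ρ} u∈ρ ρ⊆ c d = HasCount-resp into out
      (HasCount-⊎ (slices-disjoint ∅≢) (HasCount-slice ∅ c) (HasCount-slice ⁅ u ⁆ d))
      where
      ∅≢ : ∅ ≢ ⁅ u ⁆
      ∅≢ e = ∉⊥ (subst (u ∈_) (sym e) (x∈⁅x⁆ u))

      Target = λ X → Slice ∅ (SpanningTree G) X ⊎ Slice ⁅ u ⁆ (Separating G u h) X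

      into : ∀ {X} → Target X → Separating (extend ρ G) zero (suc h) X
      into (inj₁ (A , refl , simple , A⊆ , t)) =
        separating-slice⁺ {r = ∅} (λ x∈ → contradiction x∈ ∉⊥) simple A⊆
          (λ e → ∉⊥ (Adj-extend⁻ {r = ∅} {A} zero (suc h) e))
          (link-∅⁺ simple t)
      into (inj₂ (A , refl , simple , A⊆ , t)) =
        separating-slice⁺ (⁅⁆⊆ u∈ρ) simple A⊆
          (λ e → u≢h (sym (x∈⁅y⁆⇒x≡y u (Adj-extend⁻ {r = ⁅ u ⁆} {A} zero (suc h) e))))
          (tree-link⁺ A simple (pair-tree⁺ A simple u≢h t))

      out : ∀ {X} → Separating (extend ρ G) zero (suc h) X → Target X
      out {X} T with r , A , refl , r⊆ , simple , A⊆ , ¬e , t ← separating-slice⁻ {G = G} {X = X} T | ⊆pair-cases (λ x∈ → ρ⊆ (r⊆ x∈))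
      ... | inj₁ (inj₁ refl) = inj₁ (A , refl , simple , A⊆ , link-∅⁻ simple t)
      ... | inj₁ (inj₂ refl) = inj₂ (A , refl , simple , A⊆ , pair-tree⁻ A simple u≢h (tree-link⁻ A simple t))
      ... | inj₂ (inj₁ refl) = contradiction (Adj-extend⁺ {r = r} {A} zero (suc h) (x∈⁅x⁆ h)) ¬e
      ... | inj₂ (inj₂ refl) = contradiction (Adj-extend⁺ {r = r} {A} zero (suc h) right∈pair) ¬e

    -- The new vertex is a leaf at `u` or at `h`. Joined to both, it would form a triangle with the
    -- virtual edge.
    count-separating-old : ∀ {f} → HasCount (Separating G u h) f →
      HasCount (Separating (extend (⁅ u ⁆ ∪ ⁅ h ⁆) G) (suc u) (suc h)) (f + f)
    count-separating-old d = HasCount-resp into out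
      (HasCount-⊎ (slices-disjoint single≢) (HasCount-slice ⁅ u ⁆ d) (HasCount-slice ⁅ h ⁆ d))
      where
      leaf : ∀ {w X} → w ∈ ⁅ u ⁆ ∪ ⁅ h ⁆ → Slice ⁅ w ⁆ (Separating G u h) X →
        Separating (extend (⁅ u ⁆ ∪ ⁅ h ⁆) G) (suc u) (suc h) X
      leaf {w} w∈ (A , refl , simple , A⊆ , ¬e , t) =
        separating-slice⁺ (⁅⁆⊆ w∈) simple A⊆
          (λ e → ¬e (Adj-extend⁻ {r = ⁅ w ⁆} {A} (suc u) (suc h) e))
          (tree-sucs⁺ A simple (singleton⁺ (AddEdge-sym {R = Adj A} (Adj-symmetric A simple)) t))

      Target = λ X → Slice ⁅ u ⁆ (Separating G u h) X ⊎ Slice ⁅ h ⁆ (Separating G u h) X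

      into : ∀ {X} → Target X → Separating (extend (⁅ u ⁆ ∪ ⁅ h ⁆) G) (suc u) (suc h) X
      into (inj₁ p) = leaf left∈pair p
      into (inj₂ p) = leaf right∈pair p

      out : ∀ {X} → Separating (extend (⁅ u ⁆ ∪ ⁅ h ⁆) G) (suc u) (suc h) X → Target X
      out {X} T with r , A , refl , r⊆ , simple , A⊆ , ¬e , t ← separating-slice⁻ {G = G} {X = X} T | ⊆pair-cases r⊆
      ... | inj₁ (inj₁ refl) = contradiction (tree-sucs⁻ A simple t) (∅-¬tree u)
      ... | inj₁ (inj₂ refl) = inj₁ (A , refl , simple , A⊆ , ¬e ∘ Adj-extend⁺ {r = r} {A} (suc u) (suc h) ,
                                     singleton⁻ (tree-sucs⁻ A simple t))
      ... | inj₂ (inj₁ refl) = inj₂ (A , refl , simple , A⊆ , ¬e ∘ Adj-extend⁺ {r = r} {A} (suc u) (suc h) ,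
                                     singleton⁻ (tree-sucs⁻ A simple t))
      ... | inj₂ (inj₂ refl) = contradiction (tree-sucs⁻ A simple t)
        (triangle-¬tree {R = AddEdge (Adj A) u h} left∈pair right∈pair u≢h (inj₂ (inj₁ (refl , refl))))

count-spanning : ∀ {n} {G : Adjacency n} {k} → HasCount (SpanningTree G) k → NumSpanningTrees G k
count-spanning = HasCount-resp
  (λ {X} (simple , sub , t) → simple , sub , TreeRel⇒IsTree {A = X} simple t)
  (λ {X} (simple , sub , t) → simple , sub , IsTree⇒TreeRel {A = X} simple t)

-- Drawing on a parabola

2ab<a²+b² : ∀ {a b} → a ≢ b → 2 * (b * a) + 1 ≤ a * a + b * b
2ab<a²+b² {a} {b} a≢b with ℕ.<-cmp a b
... | tri≈ _ a≡b _ = contradiction a≡b a≢b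
... | tri< a<b _ _ with o , refl ← m≤n⇒∃[o]m+o≡n a<b =
  -- With b = a + 1 + o the difference of the squares' sum and the double product is (1 + o)² = 1 +
  -- o (2 + o).
  ≤-trans (m≤m+n _ (o * (2 + o))) (≤-reflexive (expand a o))
  where
  expand : ∀ a o → 2 * ((suc a + o) * a) + 1 + o * (2 + o) ≡ a * a + (suc a + o) * (suc a + o)
  expand = solve-∀
... | tri> _ _ b<a with o , refl ← m≤n⇒∃[o]m+o≡n b<a =
  ≤-trans (m≤m+n _ (o * (2 + o))) (≤-reflexive (expand b o))
  where
  expand : ∀ b o → 2 * (b * (suc b + o)) + 1 + o * (2 + o) ≡ (suc b + o) * (suc b + o) + b * b
  expand = solve-∀

-- The tangent to the parabola at k passes below the chord from i to j, and
-- above the segment from k to the point (h , 0) when k ≤ h.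
chord-misses-spoke : ∀ {p q e t i j k h} → 0 < e + t → p + q ≡ e + t → i ≢ k → j ≢ k → k ≤ h →
  p * i + q * j ≡ e * k + t * h → p * (i * i) + q * (j * j) ≢ e * (k * k) + t * 0
chord-misses-spoke {p} {q} {e} {t} {i} {j} {k} {h} d>0 d≡ i≢k j≢k k≤h xs ys =
  <-irrefl refl (begin-strict
    e * (k * k) + t * 0 + (e + t) * (k * k)       ≤⟨ m≤m+n _ (t * (k * k)) ⟩
    e * (k * k) + t * 0 + (e + t) * (k * k) + t * (k * k) ≡⟨ regroup e t k ⟩
    2 * k * (e * k + t * k)                       ≤⟨ *-monoʳ-≤ (2 * k) (+-monoʳ-≤ (e * k) (*-monoʳ-≤ t k≤h)) ⟩
    2 * k * (e * k + t * h)                       <⟨ m<m+n _ d>0 ⟩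
    2 * k * (e * k + t * h) + (e + t)             ≡⟨ cong₂ (λ a b → 2 * k * a + b) xs d≡ ⟨
    2 * k * (p * i + q * j) + (p + q)             ≡⟨ regroup′ p q i j k ⟩
    p * (2 * (k * i) + 1) + q * (2 * (k * j) + 1) ≤⟨ +-mono-≤ (*-monoʳ-≤ p (2ab<a²+b² i≢k)) (*-monoʳ-≤ q (2ab<a²+b² j≢k)) ⟩
    p * (i * i + k * k) + q * (j * j + k * k)     ≡⟨ regroup″ p q i j k ⟩
    p * (i * i) + q * (j * j) + (p + q) * (k * k) ≡⟨ cong₂ _+_ ys (cong (_* (k * k)) d≡) ⟩
    e * (k * k) + t * 0 + (e + t) * (k * k)       ∎)
  where
  regroup : ∀ e t k → e * (k * k) + t * 0 + (e + t) * (k * k) + t * (k * k) ≡ 2 * k * (e * k + t * k)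
  regroup = solve-∀
  regroup′ : ∀ p q i j k → 2 * k * (p * i + q * j) + (p + q) ≡
    p * (2 * (k * i) + 1) + q * (2 * (k * j) + 1)
  regroup′ = solve-∀
  regroup″ : ∀ p q i j k → p * (i * i + k * k) + q * (j * j + k * k) ≡
    p * (i * i) + q * (j * j) + (p + q) * (k * k)
  regroup″ = solve-∀

-- The segment from (k , k²) to (h , 0) never rises above k², which excludes m > k, and never goes
-- left of k, which excludes m < k.
spoke-misses-vertex : ∀ {e t d k m h} → 0 < d → e + t ≡ d → k ≢ m → k ≤ h →
  e * k + t * h ≡ d * m → e * (k * k) + t * 0 ≢ d * (m * m)
spoke-misses-vertex {e} {t} {d} {k} {m} {h} d>0 refl k≢m k≤h xs ys with ℕ.<-cmp k m
... | tri≈ _ k≡m _ = k≢m k≡m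
... | tri< k<m _ _ = <-irrefl ys (begin-strict
  e * (k * k) + t * 0       ≤⟨ +-monoʳ-≤ (e * (k * k)) (*-monoʳ-≤ t z≤n) ⟩
  e * (k * k) + t * (k * k) ≡⟨ *-distribʳ-+ (k * k) e t ⟨
  d * (k * k)               <⟨ *-monoʳ-< d {{>-nonZero d>0}} (*-mono-< k<m k<m) ⟩
  d * (m * m)               ∎)
... | tri> _ _ m<k = <-irrefl (sym xs) (begin-strict
  d * m         <⟨ *-monoʳ-< d {{>-nonZero d>0}} m<k ⟩
  d * k         ≡⟨ *-distribʳ-+ k e t ⟩
  e * k + t * k ≤⟨ +-monoʳ-≤ (e * k) (*-monoʳ-≤ t k≤h) ⟩
  e * k + t * h ∎)

-- Segments over disjoint ranges of abscissae do not meet. The weights are not normalised; their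
-- equal totals act as a common denominator.
weighted-< : ∀ p q e t {a b i j k l} → 0 < p + q → p + q ≡ e + t → a < b →
  i ≤ a → j ≤ a → b ≤ k → b ≤ l → p * i + q * j < e * k + t * l
weighted-< p q e t {a} {b} {i} {j} {k} {l} d>0 d≡ a<b i≤ j≤ ≤k ≤l = begin-strict
  p * i + q * j ≤⟨ +-mono-≤ (*-monoʳ-≤ p i≤) (*-monoʳ-≤ q j≤) ⟩
  p * a + q * a ≡⟨ *-distribʳ-+ a p q ⟨
  (p + q) * a   <⟨ *-monoʳ-< (p + q) {{>-nonZero d>0}} a<b ⟩
  (p + q) * b   ≡⟨ cong (_* b) d≡ ⟩
  (e + t) * b   ≡⟨ *-distribʳ-+ b e t ⟩
  e * b + t * b ≤⟨ +-mono-≤ (*-monoʳ-≤ e ≤k) (*-monoʳ-≤ t ≤l) ⟩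
  e * k + t * l ∎

module _ {H : ℕ} (G : Adjacency (suc H)) (simple : IsSimple G) where

  private
    V = Fin (suc H)

  hub : V
  hub = fromℕ H

  -- All vertices but the hub lie on y = x². The hub has the largest abscissa and is lowered to the
  -- axis, so that every spoke stays on or below the tangent at its other end.
  height : V → ℕ
  height i with i ≟ hub
  ... | yes _ = 0
  ... | no _ = toℕ i * toℕ i

  height-hub : height hub ≡ 0
  height-hub with hub ≟ hub
  ... | yes _ = refl
  ... | no h≢h = contradiction refl h≢h

  height-old : ∀ {i} → i ≢ hub → height i ≡ toℕ i * toℕ i
  height-old {i} i≢h with i ≟ hub
  ... | yes i≡h = contradiction i≡h i≢h
  ... | no _ = refl

  position : V → Point
  position i = ℤ.+ toℕ i , ℤ.+ height i

  -- Common points in barycentric form over ℕ. With all four weights explicit the endpoints of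
  -- either segment can be exchanged, and a vertex on a segment is the degenerate case c = d.
  record Meets (a b c d : V) : Set where
    constructor meets
    field
      p q e t : ℕ
      positive : 0 < p + q
      total : p + q ≡ e + t
      abscissa : p * toℕ a + q * toℕ b ≡ e * toℕ c + t * toℕ d
      ordinate : p * height a + q * height b ≡ e * height c + t * height d

  Meets-swapˡ : ∀ {a b c d} → Meets a b c d → Meets b a c d
  Meets-swapˡ (meets p q e t d>0 d≡ xs ys) =
    meets q p e t (subst (0 <_) (+-comm p q) d>0) (trans (+-comm q p) d≡)
      (trans (+-comm (q * _) _) xs) (trans (+-comm (q * _) _) ys)

  Meets-exchange : ∀ {a b c d} → Meets a b c d → Meets c d a b
  Meets-exchange (meets p q e t d>0 d≡ xs ys) = meets e t p q (subst (0 <_) d≡ d>0) (sym d≡) (sym xs) (sym ys)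

  Meets-swapʳ : ∀ {a b c d} → Meets a b c d → Meets a b d c
  Meets-swapʳ = Meets-exchange ∘ Meets-swapˡ ∘ Meets-exchange

  pos-weighted : ∀ p a q b → (ℤ.+ p) ℤ.* (ℤ.+ a) ℤ.+ (ℤ.+ q) ℤ.* (ℤ.+ b) ≡ ℤ.+ (p * a + q * b)
  pos-weighted p a q b = cong₂ ℤ._+_ (sym (ℤ.pos-* p a)) (sym (ℤ.pos-* q b))

  SegmentsMeet⇒Meets : ∀ {a b c d} →
    SegmentsMeet (position a) (position b) (position c) (position d) → Meets a b c d
  SegmentsMeet⇒Meets (d , s , t , d>0 , s≤d , t≤d , xs , ys) =
    meets (d ∸ s) s (d ∸ t) t (subst (0 <_) (sym (m∸n+n≡m s≤d)) d>0) (trans (m∸n+n≡m s≤d) (sym (m∸n+n≡m t≤d)))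
      (convert _ _ _ _ xs) (convert _ _ _ _ ys)
    where
    convert : ∀ a b c e →
      (ℤ.+ (d ∸ s)) ℤ.* (ℤ.+ a) ℤ.+ (ℤ.+ s) ℤ.* (ℤ.+ b) ≡ (ℤ.+ (d ∸ t)) ℤ.* (ℤ.+ c) ℤ.+ (ℤ.+ t) ℤ.* (ℤ.+ e) →
      (d ∸ s) * a + s * b ≡ (d ∸ t) * c + t * e
    convert a b c e eq = ℤ.+-injective
      (trans (sym (pos-weighted (d ∸ s) a s b)) (trans eq (pos-weighted (d ∸ t) c t e)))

  OnSegment⇒Meets : ∀ {w a b} → OnSegment (position w) (position a) (position b) → Meets a b w w
  OnSegment⇒Meets {w} (d , s , d>0 , s≤d , xs , ys) =
    meets (d ∸ s) s d 0 (subst (0 <_) (sym (m∸n+n≡m s≤d)) d>0) (trans (m∸n+n≡m s≤d) (sym (+-identityʳ d)))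
      (convert _ _ _ xs) (convert _ _ _ ys)
    where
    convert : ∀ w a b → (ℤ.+ d) ℤ.* (ℤ.+ w) ≡ (ℤ.+ (d ∸ s)) ℤ.* (ℤ.+ a) ℤ.+ (ℤ.+ s) ℤ.* (ℤ.+ b) →
      (d ∸ s) * a + s * b ≡ d * w + 0 * w
    convert w a b eq = trans (ℤ.+-injective
      (trans (sym (pos-weighted (d ∸ s) a s b)) (trans (sym eq) (sym (ℤ.pos-* d w)))))
      (sym (+-identityʳ (d * w)))

  Chord : V → V → Set
  Chord i j = Adj G i j × toℕ i < toℕ j × j ≢ hub

  -- Nested chords are excluded as well, which is more than planarity asks for; in return, abscissae
  -- alone keep two chords apart.
  NonCrossing : Set
  NonCrossing = ∀ {i j k l} → Chord i j → Chord k l →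
    i ≢ k → i ≢ l → j ≢ k → j ≢ l → toℕ j < toℕ k ⊎ toℕ l < toℕ i

  ≤hub : ∀ i → toℕ i ≤ toℕ hub
  ≤hub i = subst (toℕ i ≤_) (sym (toℕ-fromℕ H)) (toℕ≤pred[n] {suc H} i)

  <⇒≢hub : ∀ {i j : V} → toℕ i < toℕ j → i ≢ hub
  <⇒≢hub {j = j} i<j refl = <-irrefl refl (≤-trans i<j (≤hub j))

  ≢hub⇒< : ∀ {i : V} → i ≢ hub → toℕ i < toℕ hub
  ≢hub⇒< {i} i≢h = ≤∧≢⇒< (≤hub i) (i≢h ∘ toℕ-injective)

  Forward : V → V → Set
  Forward i j = Adj G i j × toℕ i < toℕ j

  orient : ∀ {i j} → Adj G i j → Forward i j ⊎ Forward j i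
  orient {i} {j} e with ℕ.<-cmp (toℕ i) (toℕ j)
  ... | tri< i<j _ _ = inj₁ (e , i<j)
  ... | tri> _ _ j<i = inj₂ (Adj-symmetric G simple {i} e , j<i)
  ... | tri≈ _ i≡j _ rewrite toℕ-injective i≡j = contradiction e (Adj-irrefl {A = G} simple {j})

  chord-spoke : ∀ {i j k} → Chord i j → k ≢ hub → i ≢ k → j ≢ k → ¬ Meets i j k hub
  chord-spoke {i} {j} {k} (_ , i<j , j≢h) k≢h i≢k j≢k (meets p q e t d>0 d≡ xs ys) =
    chord-misses-spoke {p} {q} {e} {t} (subst (0 <_) d≡ d>0) d≡
      (i≢k ∘ toℕ-injective) (j≢k ∘ toℕ-injective) (≤hub k) xs
      (subst₂ (λ a b → _ ≡ e * a + t * b) (height-old k≢h) height-hub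
        (subst₂ (λ a b → p * a + q * b ≡ _) (height-old (<⇒≢hub i<j)) (height-old j≢h) ys))

  forward-disjoint : NonCrossing → ∀ {a b c d} → Forward a b → Forward c d →
    a ≢ c → a ≢ d → b ≢ c → b ≢ d → ¬ Meets a b c d
  forward-disjoint noncrossing {a} {b} {c} {d} (ab , a<b) (cd , c<d) a≢c a≢d b≢c b≢d m
    with b ≟ hub | d ≟ hub
  ... | yes refl | yes refl = b≢d refl
  ... | yes refl | no d≢h = chord-spoke (cd , c<d , d≢h) (<⇒≢hub a<b) (≢-sym a≢c) (≢-sym a≢d) (Meets-exchange m)
  ... | no b≢h | yes refl = chord-spoke (ab , a<b , b≢h) (<⇒≢hub c<d) a≢c b≢c m
  ... | no b≢h | no d≢h with noncrossing (ab , a<b , b≢h) (cd , c<d , d≢h) a≢c a≢d b≢c b≢d | m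
  ... | inj₁ b<c | meets p q e t d>0 d≡ xs _ =
    <-irrefl xs (weighted-< p q e t d>0 d≡ b<c (<⇒≤ a<b) ≤-refl ≤-refl (<⇒≤ c<d))
  ... | inj₂ d<a | meets p q e t d>0 d≡ xs _ =
    <-irrefl (sym xs) (weighted-< e t p q (subst (0 <_) d≡ d>0) (sym d≡) d<a (<⇒≤ c<d) ≤-refl ≤-refl (<⇒≤ a<b))

  forward-avoids : ∀ {a b w} → Forward a b → w ≢ a → w ≢ b → ¬ Meets a b w w
  forward-avoids {a} {b} {w} (ab , a<b) w≢a w≢b m with b ≟ hub | w ≟ hub | m
  ... | yes refl | yes w≡h | _ = w≢b w≡h
  ... | yes refl | no w≢h | meets p q e t d>0 d≡ xs ys =
    spoke-misses-vertex {p} {q} d>0 refl (≢-sym w≢a ∘ toℕ-injective) (≤hub a)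
      (trans xs (merge (toℕ w)))
      (trans (subst₂ (λ x y → p * x + q * y ≡ e * height w + t * height w) (height-old (<⇒≢hub a<b)) height-hub ys)
        (trans (merge (height w)) (cong ((p + q) *_) (height-old w≢h))))
    where
    merge : ∀ x → e * x + t * x ≡ (p + q) * x
    merge x = trans (sym (*-distribʳ-+ x e t)) (cong (_* x) (sym d≡))
  ... | no b≢h | yes refl | meets p q e t d>0 d≡ xs _ =
    <-irrefl xs (weighted-< p q e t d>0 d≡ (≢hub⇒< b≢h) (<⇒≤ a<b) ≤-refl ≤-refl ≤-refl)
  ... | no b≢h | no w≢h | meets p q e t d>0 d≡ xs ys =
    -- The vertex `w` is a point of the segment from `w` to the hub, with weight 0 at the hub;
    -- `chord-spoke` does not ask this segment to be an edge.
    chord-spoke (ab , a<b , b≢h) w≢h (≢-sym w≢a) (≢-sym w≢b)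
      (meets p q (e + t) 0 d>0 (trans d≡ (sym (+-identityʳ _)))
        (trans xs (merge (toℕ w))) (trans ys (merge (height w))))
    where
    merge : ∀ x → e * x + t * x ≡ (e + t) * x + 0
    merge x = trans (sym (*-distribʳ-+ x e t)) (sym (+-identityʳ _))

  noncrossing⇒planar : NonCrossing → IsPlanar G
  noncrossing⇒planar noncrossing = position ,
    (λ e → toℕ-injective (ℤ.+-injective (cong proj₁ e))) ,
    (λ u v w uv w≢u w≢v on → let m = OnSegment⇒Meets {w} {u} {v} on in
      [ (λ f → forward-avoids f w≢u w≢v m) , (λ f → forward-avoids f w≢v w≢u (Meets-swapˡ m)) ]′ (orient uv)) ,
    (λ a b c d ab cd a≢c a≢d b≢c b≢d meet → let m = SegmentsMeet⇒Meets {a} {b} {c} {d} meet in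
      [ (λ f → [ (λ g → forward-disjoint noncrossing f g a≢c a≢d b≢c b≢d m)
               , (λ g → forward-disjoint noncrossing f g a≢d a≢c b≢d b≢c (Meets-swapʳ m)) ]′ (orient cd))
      , (λ f → [ (λ g → forward-disjoint noncrossing f g b≢c b≢d a≢c a≢d (Meets-swapˡ m))
               , (λ g → forward-disjoint noncrossing f g b≢d b≢c a≢d a≢c (Meets-swapˡ (Meets-swapʳ m))) ]′ (orient cd)) ]′
      (orient ab))

-- Hubs over caterpillars

-- Each letter adds a vertex joined to the tip. S and P make the new vertex the
-- tip, P and W also join it to the hub.
data Letter : Set where
  S P W : Letter

row : ∀ {n} → Fin n → Fin n → Letter → Subset n
row u h S = ⁅ u ⁆
row u h P = ⁅ u ⁆ ∪ ⁅ h ⁆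
row u h W = ⁅ u ⁆ ∪ ⁅ h ⁆

apex : ∀ (c : List Letter) → Fin (2 + length c)
apex c = fromℕ (suc (length c))

tip : ∀ (c : List Letter) → Fin (2 + length c)
tip [] = zero
tip (S ∷ c) = zero
tip (P ∷ c) = zero
tip (W ∷ c) = suc (tip c)

vertex : Adjacency 1
vertex = (false ∷ []) ∷ []

graph : ∀ (c : List Letter) → Adjacency (2 + length c)
graph [] = extend ⁅ zero ⁆ vertex
graph (l ∷ c) = extend (row (tip c) (apex c) l) (graph c)

trees forests : List Letter → ℕ
trees [] = 1
trees (S ∷ c) = trees c
trees (P ∷ c) = trees c + (trees c + forests c)
trees (W ∷ c) = trees c + (trees c + forests c)
forests [] = 1
forests (S ∷ c) = trees c + forests c
forests (P ∷ c) = trees c + forests c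
forests (W ∷ c) = forests c + forests c

tip≢apex : ∀ (c : List Letter) → tip c ≢ apex c
tip≢apex [] ()
tip≢apex (S ∷ c) ()
tip≢apex (P ∷ c) ()
tip≢apex (W ∷ c) = tip≢apex c ∘ suc-injective

vertex-simple : IsSimple vertex
vertex-simple = (λ { zero zero → refl }) , (λ { zero → refl })

graph-simple : ∀ (c : List Letter) → IsSimple (graph c)
graph-simple [] = IsSimple-extend⁺ {r = ⁅ zero ⁆} {vertex} vertex-simple
graph-simple (l ∷ c) = IsSimple-extend⁺ {r = row (tip c) (apex c) l} {graph c} (graph-simple c)

vertex-tree : TreeRel (Adj vertex)
vertex-tree = (λ { zero zero → ε }) , (λ { {zero} {zero} () })

count-vertex : HasCount (SpanningTree vertex) 1
count-vertex = vertex ∷ [] , refl , ([] ∷ []) , λ X → mk⇔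
  (λ { (here refl) → vertex-simple , (λ _ _ e → e) , vertex-tree })
  (λ { (simple , _) → here (unique X simple) })
  where
  unique : ∀ X → IsSimple X → X ≡ vertex
  unique ((x ∷ []) ∷ []) (_ , d) = cong (λ x → (x ∷ []) ∷ []) (d zero)

count-edge : HasCount (Separating (graph []) zero (suc zero)) 1
count-edge = HasCount-resp into out (HasCount-slice ∅ count-vertex)
  where
  into : ∀ {X} → Slice ∅ (SpanningTree vertex) X → Separating (graph []) zero (suc zero) X
  into (A , refl , simple , A⊆ , t) =
    separating-slice⁺ {ρ = ⁅ zero ⁆} {G = vertex} {r = ∅} (λ x∈ → contradiction x∈ ∉⊥) simple A⊆ (λ ()) (link-∅⁺ simple t)

  out : ∀ {X} → Separating (graph []) zero (suc zero) X → Slice ∅ (SpanningTree vertex) X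
  out {X} T with r , A , refl , r⊆ , simple , A⊆ , ¬e , t ← separating-slice⁻ {ρ = ⁅ zero ⁆} {G = vertex} {X = X} T
               | ⊆⁅⁆-cases {u = zero} r⊆
  ... | inj₁ refl = A , refl , simple , A⊆ , link-∅⁻ simple t
  ... | inj₂ refl = contradiction refl ¬e

tip∈row : ∀ {n} {u h : Fin n} l → u ∈ row u h l
tip∈row {u = u} S = x∈⁅x⁆ u
tip∈row P = left∈pair
tip∈row W = left∈pair

row⊆pair : ∀ {n} {u h : Fin n} l → row u h l ⊆ ⁅ u ⁆ ∪ ⁅ h ⁆
row⊆pair S = ⁅⁆⊆ left∈pair
row⊆pair P = id
row⊆pair W = id

mutual
  count-trees : ∀ (c : List Letter) → HasCount (SpanningTree (graph c)) (trees c)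
  count-trees [] = count-leaf {G = vertex} {u = zero} count-vertex
  count-trees (S ∷ c) = count-leaf (count-trees c)
  count-trees (P ∷ c) = count-triangle (tip≢apex c) (count-trees c) (count-forests c)
  count-trees (W ∷ c) = count-triangle (tip≢apex c) (count-trees c) (count-forests c)

  count-forests : ∀ (c : List Letter) → HasCount (Separating (graph c) (tip c) (apex c)) (forests c)
  count-forests [] = count-edge
  count-forests (S ∷ c) = count-separating-new (tip≢apex c) (tip∈row {h = apex c} S) (row⊆pair {h = apex c} S) (count-trees c) (count-forests c)
  count-forests (P ∷ c) = count-separating-new (tip≢apex c) (tip∈row {h = apex c} P) (row⊆pair {h = apex c} P) (count-trees c) (count-forests c)
  count-forests (W ∷ c) = count-separating-old (tip≢apex c) (count-forests c)

graph-step : ∀ l (c : List Letter) {i j} → Adj (graph (l ∷ c)) i j → Extend (_∈ row (tip c) (apex c) l) (Adj (graph c)) i j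
graph-step l c {i} {j} = Adj-extend⁻ {r = row (tip c) (apex c) l} {A = graph c} i j

module _ (c : List Letter) where

  GraphChord : Fin (2 + length c) → Fin (2 + length c) → Set
  GraphChord = Chord (graph c) (graph-simple c)

chord-old : ∀ l (c : List Letter) {i j} → GraphChord (l ∷ c) (suc i) (suc j) → GraphChord c i j
chord-old l c (e , s≤s i<j , j≢) = graph-step l c {suc _} {suc _} e , i<j , j≢ ∘ cong suc

chord-new : ∀ l (c : List Letter) {j} → GraphChord (l ∷ c) zero (suc j) → j ≡ tip c
chord-new l c {j} (e , _ , j≢) with pair⁻ {u = tip c} {v = apex c} (row⊆pair l (graph-step l c {zero} {suc j} e))
... | inj₁ j≡tip = j≡tip
... | inj₂ refl = contradiction refl j≢

-- The vertices with smaller index than the tip are the leaves that W has hung on it, and their only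
-- chord leads to the tip.
chord-behind-tip : ∀ (c : List Letter) {i j} → GraphChord c i j → j ≡ tip c ⊎ toℕ (tip c) ≤ toℕ i
chord-behind-tip [] _ = inj₂ z≤n
chord-behind-tip (S ∷ c) _ = inj₂ z≤n
chord-behind-tip (P ∷ c) _ = inj₂ z≤n
chord-behind-tip (W ∷ c) {zero} {suc j} ch = inj₁ (cong suc (chord-new W c ch))
chord-behind-tip (W ∷ c) {suc i} {suc j} ch with chord-behind-tip c (chord-old W c ch)
... | inj₁ e = inj₁ (cong suc e)
... | inj₂ le = inj₂ (s≤s le)

new-chord-first : ∀ l (c : List Letter) {j k m} → GraphChord (l ∷ c) zero (suc j) → GraphChord c k m →
  j ≢ k → j ≢ m → toℕ j < toℕ k
new-chord-first l c {j} {k} new old j≢k j≢m with refl ← chord-new l c new | chord-behind-tip c old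
... | inj₁ m≡tip = contradiction (sym m≡tip) j≢m
... | inj₂ tip≤k = ≤∧≢⇒< tip≤k (j≢k ∘ toℕ-injective)

graph-noncrossing : ∀ (c : List Letter) → NonCrossing (graph c) (graph-simple c)
graph-noncrossing [] {zero} {suc zero} (_ , _ , j≢) = contradiction refl j≢
graph-noncrossing [] {suc zero} {suc zero} (_ , s≤s () , _)
graph-noncrossing (l ∷ c) {zero} {_} {zero} _ _ i≢k _ _ _ = contradiction refl i≢k
graph-noncrossing (l ∷ c) {zero} {suc j} {suc k} {suc m} ch ch′ i≢k i≢l j≢k j≢l =
  inj₁ (s≤s (new-chord-first l c ch (chord-old l c ch′) (j≢k ∘ cong suc) (j≢l ∘ cong suc)))
graph-noncrossing (l ∷ c) {suc i} {suc j} {zero} {suc m} ch ch′ i≢k i≢l j≢k j≢l =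
  inj₂ (s≤s (new-chord-first l c ch′ (chord-old l c ch) (i≢l ∘ cong suc ∘ sym) (j≢l ∘ cong suc ∘ sym)))
graph-noncrossing (l ∷ c) {suc i} {suc j} {suc k} {suc m} ch ch′ i≢k i≢l j≢k j≢l
  with graph-noncrossing c (chord-old l c ch) (chord-old l c ch′)
         (i≢k ∘ cong suc) (i≢l ∘ cong suc) (j≢k ∘ cong suc) (j≢l ∘ cong suc)
... | inj₁ lt = inj₁ (s≤s lt)
... | inj₂ lt = inj₂ (s≤s lt)

trees∈Tpla : ∀ (c : List Letter) → Tpla (2 + length c) (trees c)
trees∈Tpla c = graph c , graph-simple c ,
  noncrossing⇒planar (graph c) (graph-simple c) (graph-noncrossing c) ,
  count-spanning {G = graph c} (count-trees c)

-- Words of blocks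

Block : Set
Block = Fin 3 × Fin 3

-- Lists start with the newest letter, so a block appears reversed, and the last block created is
-- the head of the word.
letters : List Block → List Letter
letters [] = []
letters ((j , k) ∷ w) = replicate (toℕ k) W ++ P ∷ replicate (toℕ j) S ++ letters w

trees-tails : ∀ j c → trees (replicate j S ++ c) ≡ trees c
trees-tails zero c = refl
trees-tails (suc j) c = trees-tails j c

forests-tails : ∀ j c → forests (replicate j S ++ c) ≡ forests c + j * trees c
forests-tails zero c = sym (+-identityʳ _)
forests-tails (suc j) c rewrite trees-tails j c | forests-tails j c = shuffle (trees c) (forests c) (j * trees c)
  where
  shuffle : ∀ t f x → t + (f + x) ≡ f + (t + x)
  shuffle = solve-∀

-- Pairs (t , g) stand for the weights after the P of a block: (t + g , g).
attach : Fin 3 → ℕ → ℕ → ℕ × ℕ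
attach zero t g = t + g , g
attach (suc zero) t g = 2 * t + 3 * g , 2 * g
attach (suc (suc zero)) t g = 4 * t + 8 * g , 4 * g

weights : List Letter → ℕ × ℕ
weights c = trees c , forests c

-- P adds `t` to the forests exactly as S does. Hence the `suc j`.
weights-block : ∀ j k c → let t = trees c in
  weights (replicate (toℕ k) W ++ P ∷ replicate j S ++ c) ≡ attach k t (forests c + suc j * t)
weights-block j k c = trans (lemma k) (cong (λ x → attach k (trees c) x) (shuffle (trees c) (forests c) (j * trees c)))
  where
  shuffle : ∀ t f x → t + (f + x) ≡ f + (t + x)
  shuffle = solve-∀
  one : ∀ t x → t + x + (t + x + x) ≡ 2 * t + 3 * x
  one = solve-∀
  three : ∀ t g → t + g + (t + g + g) + (t + g + (t + g + g) + (g + g)) ≡ 4 * t + 8 * g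
  three = solve-∀
  two : ∀ g → g + g ≡ 2 * g
  two = solve-∀
  four : ∀ g → g + g + (g + g) ≡ 4 * g
  four = solve-∀
  lemma : ∀ k → weights (replicate (toℕ k) W ++ P ∷ replicate j S ++ c) ≡
    attach k (trees c) (trees c + (forests c + j * trees c))
  lemma k rewrite sym (forests-tails j c) | sym (trees-tails j c) with replicate j S ++ c | k
  ... | d | zero = refl
  ... | d | suc zero = cong₂ _,_ (one (trees d) (trees d + forests d)) (two (trees d + forests d))
  ... | d | suc (suc zero) = cong₂ _,_ (three (trees d) (trees d + forests d)) (four (trees d + forests d))

-- Reading the last block off the weights

Balanced : ℕ → ℕ → Set
Balanced t f = 0 < f × f ≤ t × t < 3 * f

-- The new ratio is 1 + t / g + k / 2 with 0 < t / g < 1, and k ≤ 2 keeps it below 3. Its being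
-- strictly above 1 will tell a nonempty word from the empty one, whose ratio is 1.
attach-balanced : ∀ k {t g} → 0 < t → t < g → let (t′ , f′) = attach k t g in
  0 < f′ × f′ < t′ × t′ < 3 * f′
attach-balanced zero {t} {g} t>0 t<g = ≤-trans (s≤s z≤n) t<g , m<n+m g t>0 ,
  (begin-strict
    t + g     <⟨ +-monoˡ-< g t<g ⟩
    g + g     ≤⟨ m≤m+n (g + g) g ⟩
    g + g + g ≡⟨ triple g ⟩
    3 * g     ∎)
  where
  triple : ∀ g → g + g + g ≡ 3 * g
  triple = solve-∀
attach-balanced (suc zero) {t} {g} t>0 t<g =
  *-monoʳ-< 2 (≤-trans (s≤s z≤n) t<g) ,
  (begin-strict
    2 * g         <⟨ m<n+m (2 * g) (*-monoʳ-< 2 t>0) ⟩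
    2 * t + 2 * g ≤⟨ +-monoʳ-≤ (2 * t) (*-monoˡ-≤ g (m≤m+n 2 1)) ⟩
    2 * t + 3 * g ∎) ,
  (begin-strict
    2 * t + 3 * g     <⟨ +-monoˡ-< (3 * g) (*-monoʳ-< 2 t<g) ⟩
    2 * g + 3 * g     ≤⟨ m≤m+n _ g ⟩
    2 * g + 3 * g + g ≡⟨ six g ⟩
    3 * (2 * g)       ∎)
  where
  six : ∀ g → 2 * g + 3 * g + g ≡ 3 * (2 * g)
  six = solve-∀
attach-balanced (suc (suc zero)) {t} {g} t>0 t<g =
  *-monoʳ-< 4 (≤-trans (s≤s z≤n) t<g) ,
  (begin-strict
    4 * g         <⟨ m<n+m (4 * g) (*-monoʳ-< 4 t>0) ⟩
    4 * t + 4 * g ≤⟨ +-monoʳ-≤ (4 * t) (*-monoˡ-≤ g (m≤m+n 4 4)) ⟩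
    4 * t + 8 * g ∎) ,
  (begin-strict
    4 * t + 8 * g <⟨ +-monoˡ-< (8 * g) (*-monoʳ-< 4 t<g) ⟩
    4 * g + 8 * g ≡⟨ twelve g ⟩
    3 * (4 * g)   ∎)
  where
  twelve : ∀ g → 4 * g + 8 * g ≡ 3 * (4 * g)
  twelve = solve-∀

suc-block : ∀ j {t f} → Balanced t f → 0 < t × t < f + suc j * t
suc-block j {t} {f} (f>0 , f≤t , _) = ≤-trans f>0 f≤t ,
  ≤-trans (m<n+m t f>0) (+-monoʳ-≤ f (m≤m+n t (j * t)))

letters-balanced : ∀ w → Balanced (trees (letters w)) (forests (letters w))
block-balanced : ∀ b w → let c = letters (b ∷ w) in
  0 < forests c × forests c < trees c × trees c < 3 * forests c
letters-balanced [] = s≤s z≤n , s≤s z≤n , s≤s (s≤s z≤n)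
letters-balanced (b ∷ w) with f>0 , f<t , t<3f ← block-balanced b w = f>0 , <⇒≤ f<t , t<3f
block-balanced (j , k) w with t>0 , t<g ← suc-block (toℕ j) (letters-balanced w) =
  subst (λ (t , f) → 0 < f × f < t × t < 3 * f) (sym (weights-block (toℕ j) k (letters w)))
    (attach-balanced k t>0 t<g)

-- If two consecutive values of k gave equal weights, then t / g would exceed
-- t′ / g′ by 1/2; but t′ / g′ ≥ 1/4, while t / g ≤ 1/2 or, when j = 0, t / g < 3/4.
no-half-shift : ∀ (j j′ : Fin 3) {t f t′ f′} → Balanced t f → Balanced t′ f′ →
  let g = f + suc (toℕ j) * t; g′ = f′ + suc (toℕ j′) * t′ in
  g ≡ 2 * g′ → t ≢ g′ + 2 * t′
no-half-shift zero j′ {t} {f} {t′} {f′} (_ , _ , t<3f) (_ , f′≤t′ , _) g≡ t≡ =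
  <-irrefl refl (begin-strict
    g′ + 8 * t′          ≡⟨ split g′ t′ ⟩
    g′ + 2 * t′ + 6 * t′ ≡⟨ cong (_+ 6 * t′) (sym t≡) ⟩
    t + 6 * t′           <⟨ +-monoˡ-< (6 * t′) t<3f ⟩
    3 * f + 6 * t′       ≡⟨ factor f t′ ⟩
    3 * (f + 2 * t′)     ≡⟨ cong (3 *_) difference ⟩
    3 * g′               ≤⟨ +-monoʳ-≤ g′ (*-monoʳ-≤ 2 g′≤4t′) ⟩
    g′ + 2 * (4 * t′)    ≡⟨ regroup g′ t′ ⟩
    g′ + 8 * t′          ∎)
  where
  g′ = f′ + suc (toℕ j′) * t′
  split : ∀ g t → g + 8 * t ≡ g + 2 * t + 6 * t
  split = solve-∀
  factor : ∀ f t → 3 * f + 6 * t ≡ 3 * (f + 2 * t)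
  factor = solve-∀
  regroup : ∀ g t → g + 2 * (4 * t) ≡ g + 8 * t
  regroup = solve-∀
  expand : ∀ f g t → f + 2 * t + g ≡ f + 1 * (g + 2 * t)
  expand = solve-∀
  double : ∀ g → 2 * g ≡ g + g
  double = solve-∀
  difference : f + 2 * t′ ≡ g′
  difference = +-cancelʳ-≡ g′ _ _
    (trans (expand f g′ t′) (trans (cong (λ x → f + 1 * x) (sym t≡)) (trans g≡ (double g′))))
  g′≤4t′ : g′ ≤ 4 * t′
  g′≤4t′ = +-mono-≤ f′≤t′ (*-monoˡ-≤ t′ (toℕ<n j′))
no-half-shift (suc j) j′ {t} {f} {t′} {f′} (f>0 , _) _ g≡ t≡ =
  <-irrefl (sym g≡) (begin-strict
    2 * g′                          ≤⟨ *-monoʳ-≤ 2 (m≤m+n g′ (2 * t′)) ⟩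
    2 * (g′ + 2 * t′)               ≡⟨ cong (2 *_) (sym t≡) ⟩
    2 * t                           ≤⟨ *-monoˡ-≤ t (m≤m+n 2 (toℕ j)) ⟩
    suc (suc (toℕ j)) * t           <⟨ m<n+m _ f>0 ⟩
    f + suc (suc (toℕ j)) * t       ∎)
  where
  g′ = f′ + suc (toℕ j′) * t′

tails-< : ∀ {t f f′ i k} → f ≤ t → 0 < f′ → i < k → f + i * t < f′ + k * t
tails-< {t} {f} {f′} {i} {k} f≤t f′>0 i<k = begin-strict
  f + i * t  ≤⟨ +-monoˡ-≤ (i * t) f≤t ⟩
  suc i * t  ≤⟨ *-monoˡ-≤ t i<k ⟩
  k * t      <⟨ m<n+m (k * t) f′>0 ⟩
  f′ + k * t ∎

-- Division by `t` with remainder in the range from 1 to `t`: the quotient is unique.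
tails-injective : ∀ j j′ {t f f′} → 0 < f → f ≤ t → 0 < f′ → f′ ≤ t →
  f + j * t ≡ f′ + j′ * t → j ≡ j′
tails-injective j j′ f>0 f≤t f′>0 f′≤t eq with ℕ.<-cmp j j′
... | tri≈ _ j≡j′ _ = j≡j′
... | tri< j<j′ _ _ = contradiction eq (<⇒≢ (tails-< f≤t f′>0 j<j′))
... | tri> _ _ j′<j = contradiction (sym eq) (<⇒≢ (tails-< f′≤t f>0 j′<j))

attach-0≢1 : ∀ (j j′ : Fin 3) {t f t′ f′} → Balanced t f → Balanced t′ f′ →
  attach zero t (f + suc (toℕ j) * t) ≢ attach (suc zero) t′ (f′ + suc (toℕ j′) * t′)
attach-0≢1 j j′ {t} {f} {t′} {f′} B B′ e = no-half-shift j j′ B B′ g≡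
  (+-cancelʳ-≡ (2 * g′) t (g′ + 2 * t′)
    (trans (cong (t +_) (sym g≡)) (trans (cong proj₁ e) (shuffle t′ g′))))
  where
  g′ = f′ + suc (toℕ j′) * t′
  g≡ = cong proj₂ e
  shuffle : ∀ t g → 2 * t + 3 * g ≡ g + 2 * t + 2 * g
  shuffle = solve-∀

attach-1≢2 : ∀ (j j′ : Fin 3) {t f t′ f′} → Balanced t f → Balanced t′ f′ →
  attach (suc zero) t (f + suc (toℕ j) * t) ≢ attach (suc (suc zero)) t′ (f′ + suc (toℕ j′) * t′)
attach-1≢2 j j′ {t} {f} {t′} {f′} B B′ e = no-half-shift j j′ B B′ g≡
  (*-cancelˡ-≡ t (g′ + 2 * t′) 2 (+-cancelʳ-≡ (3 * (2 * g′)) (2 * t) (2 * (g′ + 2 * t′))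
    (trans (cong (λ x → 2 * t + 3 * x) (sym g≡)) (trans (cong proj₁ e) (shuffle t′ g′)))))
  where
  g = f + suc (toℕ j) * t
  g′ = f′ + suc (toℕ j′) * t′
  halve : ∀ g → 4 * g ≡ 2 * (2 * g)
  halve = solve-∀
  g≡ = *-cancelˡ-≡ g (2 * g′) 2 (trans (cong proj₂ e) (halve g′))
  shuffle : ∀ t g → 4 * t + 8 * g ≡ 2 * (g + 2 * t) + 3 * (2 * g)
  shuffle = solve-∀

-- Two letters W shift the ratio by a whole unit, so t / g would be at least 1.
attach-0≢2 : ∀ {t g t′ g′} → t < g → attach zero t g ≢ attach (suc (suc zero)) t′ g′
attach-0≢2 {t} {g} {t′} {g′} t<g e = <⇒≱ t<g (begin
  g               ≡⟨ cong proj₂ e ⟩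
  4 * g′          ≤⟨ m≤n+m (4 * g′) (4 * t′) ⟩
  4 * t′ + 4 * g′ ≡⟨ +-cancelʳ-≡ (4 * g′) t _ (trans (cong (t +_) (sym (cong proj₂ e))) (trans (cong proj₁ e) (shuffle t′ g′))) ⟨
  t               ∎)
  where
  shuffle : ∀ t g → 4 * t + 8 * g ≡ 4 * t + 4 * g + 4 * g
  shuffle = solve-∀

attach-injective : ∀ (j j′ k k′ : Fin 3) {t f t′ f′} → Balanced t f → Balanced t′ f′ →
  attach k t (f + suc (toℕ j) * t) ≡ attach k′ t′ (f′ + suc (toℕ j′) * t′) →
  (j , k) ≡ (j′ , k′) × t ≡ t′ × f ≡ f′
attach-injective j j′ k k′ {t} {f} {t′} {f′} B B′ = go k k′
  where
  g = f + suc (toℕ j) * t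
  g′ = f′ + suc (toℕ j′) * t′

  same : ∀ {k} → t ≡ t′ → g ≡ g′ → (j , k) ≡ (j′ , k) × t ≡ t′ × f ≡ f′
  same refl g≡ with refl ← toℕ-injective (ℕ.suc-injective (tails-injective (suc (toℕ j)) (suc (toℕ j′))
      (proj₁ B) (proj₁ (proj₂ B)) (proj₁ B′) (proj₁ (proj₂ B′)) g≡))
    = refl , refl , +-cancelʳ-≡ (suc (toℕ j) * t) f f′ g≡

  go : ∀ k k′ → attach k t g ≡ attach k′ t′ g′ → (j , k) ≡ (j′ , k′) × t ≡ t′ × f ≡ f′
  go zero zero e with g≡ ← cong proj₂ e =
    same (+-cancelʳ-≡ g t t′ (trans (cong proj₁ e) (cong (t′ +_) (sym g≡)))) g≡
  go (suc zero) (suc zero) e with g≡ ← *-cancelˡ-≡ g g′ 2 (cong proj₂ e) =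
    same (*-cancelˡ-≡ t t′ 2 (+-cancelʳ-≡ (3 * g) (2 * t) (2 * t′)
      (trans (cong proj₁ e) (cong (λ x → 2 * t′ + 3 * x) (sym g≡))))) g≡
  go (suc (suc zero)) (suc (suc zero)) e with g≡ ← *-cancelˡ-≡ g g′ 4 (cong proj₂ e) =
    same (*-cancelˡ-≡ t t′ 4 (+-cancelʳ-≡ (8 * g) (4 * t) (4 * t′)
      (trans (cong proj₁ e) (cong (λ x → 4 * t′ + 8 * x) (sym g≡))))) g≡
  go zero (suc zero) e = contradiction e (attach-0≢1 j j′ B B′)
  go (suc zero) zero e = contradiction (sym e) (attach-0≢1 j′ j B′ B)
  go (suc zero) (suc (suc zero)) e = contradiction e (attach-1≢2 j j′ B B′)
  go (suc (suc zero)) (suc zero) e = contradiction (sym e) (attach-1≢2 j′ j B′ B)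
  go zero (suc (suc zero)) e = contradiction e (attach-0≢2 {t} {g} {t′} {g′} (proj₂ (suc-block (toℕ j) B)))
  go (suc (suc zero)) zero e = contradiction (sym e) (attach-0≢2 {t′} {g′} {t} {g} (proj₂ (suc-block (toℕ j′) B′)))

letters-injective : ∀ w w′ → weights (letters w) ≡ weights (letters w′) → w ≡ w′
letters-injective [] [] e = refl
letters-injective [] (b ∷ w) e =
  contradiction (trans (sym (cong proj₂ e)) (cong proj₁ e)) (<⇒≢ (proj₁ (proj₂ (block-balanced b w))))
letters-injective (b ∷ w) [] e =
  contradiction (trans (cong proj₂ e) (sym (cong proj₁ e))) (<⇒≢ (proj₁ (proj₂ (block-balanced b w))))
letters-injective ((j , k) ∷ w) ((j′ , k′) ∷ w′) e
  with refl , t≡ , f≡ ← attach-injective j j′ k k′ (letters-balanced w) (letters-balanced w′)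
    (trans (sym (weights-block (toℕ j) k (letters w))) (trans e (weights-block (toℕ j′) k′ (letters w′))))
  = cong ((j , k) ∷_) (letters-injective w w′ (cong₂ _,_ t≡ f≡))

-- Enumerating the words of a given length

prepend : List (Block × List (List Block)) → List (List Block)
prepend [] = []
prepend ((b , ws) ∷ es) = map (b ∷_) ws ++ prepend es

-- A block (j , k) has 1 + j + k letters and is paired with the argument of index 4 - j - k. The
-- multiplicities 1, 2, 3, 2, 1 are the coefficients of x (1 + x + x²)². The type `A` is left open
-- so that distinctness of the blocks can be decided on a closed list.
blocks : ∀ {A : Set} → A → A → A → A → A → List (Block × A)
blocks a₀ a₁ a₂ a₃ a₄ =
  ((# 0 , # 0) , a₄) ∷
  ((# 0 , # 1) , a₃) ∷ ((# 1 , # 0) , a₃) ∷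
  ((# 0 , # 2) , a₂) ∷ ((# 1 , # 1) , a₂) ∷ ((# 2 , # 0) , a₂) ∷
  ((# 1 , # 2) , a₁) ∷ ((# 2 , # 1) , a₁) ∷
  ((# 2 , # 2) , a₀) ∷ []

-- Only one word of each length below 5 is kept, at the price of the factor 36 > (22/9)⁴
-- in words-growth.
words : ℕ → List (List Block)
words 0 = [] ∷ []
words 1 = replicate 1 (# 0 , # 0) ∷ []
words 2 = replicate 2 (# 0 , # 0) ∷ []
words 3 = replicate 3 (# 0 , # 0) ∷ []
words 4 = replicate 4 (# 0 , # 0) ∷ []
words (suc (suc (suc (suc (suc m))))) =
  prepend (blocks (words m) (words (suc m)) (words (suc (suc m)))
                  (words (suc (suc (suc m)))) (words (suc (suc (suc (suc m))))))

nextBlocks : ℕ → List (Block × List (List Block))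
nextBlocks m = blocks (words m) (words (1 + m)) (words (2 + m)) (words (3 + m)) (words (4 + m))

prepend-head : ∀ es {w} → w ∈ᴸ prepend es → ∃ λ b → ∃ λ v → w ≡ b ∷ v × b ∈ᴸ map proj₁ es
prepend-head ((b , ws) ∷ es) w∈ with ∈-++⁻ (map (b ∷_) ws) w∈
... | inj₁ w∈ws with v , _ , refl ← ∈-map⁻ (b ∷_) w∈ws = b , v , refl , here refl
... | inj₂ w∈es with c , v , refl , c∈ ← prepend-head es w∈es = c , v , refl , there c∈

prepend-unique : ∀ es → Unique (map proj₁ es) → All (Unique ∘ proj₂) es → Unique (prepend es)
prepend-unique [] _ _ = []
prepend-unique ((b , ws) ∷ es) (b∉ ∷ u) (uws ∷ us) =
  Unique.++⁺ (Unique.map⁺ ∷-injectiveʳ uws) (prepend-unique es u us) disjoint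
  where
  disjoint : ∀ {w} → ¬ (w ∈ᴸ map (b ∷_) ws × w ∈ᴸ prepend es)
  disjoint (p , q) with _ , _ , refl ← ∈-map⁻ (b ∷_) p | _ , _ , refl , b∈ ← prepend-head es q =
    All.lookup b∉ b∈ refl

prepend-All : ∀ {Q : List Block → Set} es → All (λ (b , ws) → All (λ w → Q (b ∷ w)) ws) es → All Q (prepend es)
prepend-All [] [] = []
prepend-All (_ ∷ es) (q ∷ qs) = All.++⁺ (All.map⁺ q) (prepend-All es qs)

prepend-length : ∀ es → length (prepend es) ≡ sum (map (length ∘ proj₂) es)
prepend-length [] = refl
prepend-length ((b , ws) ∷ es) = trans (length-++ (map (b ∷_) ws))
  (cong₂ _+_ (length-map (b ∷_) ws) (prepend-length es))

words-unique : ∀ m → Unique (words m)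
words-unique 0 = [] ∷ []
words-unique 1 = [] ∷ []
words-unique 2 = [] ∷ []
words-unique 3 = [] ∷ []
words-unique 4 = [] ∷ []
words-unique (suc (suc (suc (suc (suc m))))) =
  prepend-unique (nextBlocks m) distinct
    (words-unique (suc (suc (suc (suc m)))) ∷
     words-unique (suc (suc (suc m))) ∷ words-unique (suc (suc (suc m))) ∷
     words-unique (suc (suc m)) ∷ words-unique (suc (suc m)) ∷ words-unique (suc (suc m)) ∷
     words-unique (suc m) ∷ words-unique (suc m) ∷
     words-unique m ∷ [])
  where
  distinct = from-yes (DecUnique.unique? (≡-dec (_≟_ {3}) (_≟_ {3})) (map proj₁ (blocks tt tt tt tt tt)))

words-length : ∀ m → All (λ w → length (letters w) ≡ m) (words m)
words-length 0 = refl ∷ []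
words-length 1 = refl ∷ []
words-length 2 = refl ∷ []
words-length 3 = refl ∷ []
words-length 4 = refl ∷ []
words-length (suc (suc (suc (suc (suc m))))) =
  prepend-All (nextBlocks m)
    (longer 1 (words-length (suc (suc (suc (suc m))))) ∷
     longer 2 (words-length (suc (suc (suc m)))) ∷ longer 2 (words-length (suc (suc (suc m)))) ∷
     longer 3 (words-length (suc (suc m))) ∷ longer 3 (words-length (suc (suc m))) ∷ longer 3 (words-length (suc (suc m))) ∷
     longer 4 (words-length (suc m)) ∷ longer 4 (words-length (suc m)) ∷
     longer 5 (words-length m) ∷ [])
  where
  longer : ∀ d {n ws} → All (λ w → length (letters w) ≡ n) ws → All (λ w → d + length (letters w) ≡ d + n) ws
  longer d = All.map (cong (d +_))

words-growth : ∀ m → 22 ^ m ≤ 36 * 9 ^ m * length (words m)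
words-growth 0 = ≤ᵇ⇒≤ _ _ tt
words-growth 1 = ≤ᵇ⇒≤ _ _ tt
words-growth 2 = ≤ᵇ⇒≤ _ _ tt
words-growth 3 = ≤ᵇ⇒≤ _ _ tt
words-growth 4 = ≤ᵇ⇒≤ _ _ tt
words-growth (suc (suc (suc (suc (suc m))))) =
  subst (λ u → 22 ^ (5 + m) ≤ 36 * 9 ^ (5 + m) * u)
    (sym (prepend-length (nextBlocks m)))
    (recurrence (22 ^ m) (9 ^ m) (length (words m)) (length (words (1 + m))) (length (words (2 + m)))
      (length (words (3 + m))) (length (words (4 + m))) (words-growth m) (words-growth (suc m))
      (words-growth (suc (suc m))) (words-growth (suc (suc (suc m)))) (words-growth (suc (suc (suc (suc m))))))
  where
  recurrence : ∀ x y u₀ u₁ u₂ u₃ u₄ → x ≤ 36 * y * u₀ → 22 * x ≤ 36 * (9 * y) * u₁ →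
    22 * (22 * x) ≤ 36 * (9 * (9 * y)) * u₂ → 22 * (22 * (22 * x)) ≤ 36 * (9 * (9 * (9 * y))) * u₃ →
    22 * (22 * (22 * (22 * x))) ≤ 36 * (9 * (9 * (9 * (9 * y)))) * u₄ →
    22 * (22 * (22 * (22 * (22 * x)))) ≤
      36 * (9 * (9 * (9 * (9 * (9 * y))))) * (u₄ + (u₃ + (u₃ + (u₂ + (u₂ + (u₂ + (u₁ + (u₁ + (u₀ + 0)))))))))
  -- 85889 is 9⁵ times the value of x⁴ + 2x³ + 3x² + 2x + 1 − x⁵ at x = 22/9.
  recurrence x y u₀ u₁ u₂ u₃ u₄ h₀ h₁ h₂ h₃ h₄ = begin
    22 * (22 * (22 * (22 * (22 * x)))) ≤⟨ m≤m+n _ (85889 * x) ⟩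
    22 * (22 * (22 * (22 * (22 * x)))) + 85889 * x ≡⟨ left x ⟩
    -- The coefficients are 9, 2 · 9², 3 · 9³, 2 · 9⁴ and 9⁵: the multiplicity of each block length
    -- times the power of 9 that the shorter words lack.
    9 * (22 * (22 * (22 * (22 * x)))) + 162 * (22 * (22 * (22 * x))) + 2187 * (22 * (22 * x)) + 13122 * (22 * x) + 59049 * x
      ≤⟨ +-mono-≤ (+-mono-≤ (+-mono-≤ (+-mono-≤ (*-monoʳ-≤ 9 h₄) (*-monoʳ-≤ 162 h₃)) (*-monoʳ-≤ 2187 h₂)) (*-monoʳ-≤ 13122 h₁)) (*-monoʳ-≤ 59049 h₀) ⟩
    _ ≡⟨ right y u₀ u₁ u₂ u₃ u₄ ⟩
    36 * (9 * (9 * (9 * (9 * (9 * y))))) * (u₄ + (u₃ + (u₃ + (u₂ + (u₂ + (u₂ + (u₁ + (u₁ + (u₀ + 0))))))))) ∎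
    where
    left : ∀ x → 22 * (22 * (22 * (22 * (22 * x)))) + 85889 * x ≡
      9 * (22 * (22 * (22 * (22 * x)))) + 162 * (22 * (22 * (22 * x))) + 2187 * (22 * (22 * x)) + 13122 * (22 * x) + 59049 * x
    left = solve-∀
    right : ∀ y u₀ u₁ u₂ u₃ u₄ →
      9 * (36 * (9 * (9 * (9 * (9 * y)))) * u₄) + 162 * (36 * (9 * (9 * (9 * y))) * u₃) + 2187 * (36 * (9 * (9 * y)) * u₂)
        + 13122 * (36 * (9 * y) * u₁) + 59049 * (36 * y * u₀) ≡
      36 * (9 * (9 * (9 * (9 * (9 * y))))) * (u₄ + (u₃ + (u₃ + (u₂ + (u₂ + (u₂ + (u₁ + (u₁ + (u₀ + 0)))))))))
    right = solve-∀

-- From distinct pairs to distinct counts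

-- With N the number of distinct values of `x` and `y` together, an element is coded by the two
-- positions of its values, one of N² possibilities.
pigeonhole : ∀ {A : Set} {Q : ℕ → Set} (x y : A → ℕ) (ws : List A) → Unique ws →
  (∀ {a b} → x a ≡ x b → y a ≡ y b → a ≡ b) → All (λ a → Q (x a) × Q (y a)) ws →
  ∃ λ N → length ws ≤ N * N × AtLeast Q N
pigeonhole {A} {Q} x y ws uws determines qs =
  length values , injective⇒≤ code-injective ,
  lookupᴸ values , lookup-injective (DecUnique.deduplicate-! ℕ._≟_ all-values) , λ i → All.lookup values-Q (∈-lookup i)
  where
  all-values = map x ws ++ map y ws
  values = deduplicate ℕ._≟_ all-values

  x∈ : ∀ i → x (lookupᴸ ws i) ∈ᴸ values
  x∈ i = ∈-deduplicate⁺ ℕ._≟_ (∈-++⁺ˡ {xs = map x ws} (∈-map⁺ x (∈-lookup {xs = ws} i)))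

  y∈ : ∀ i → y (lookupᴸ ws i) ∈ᴸ values
  y∈ i = ∈-deduplicate⁺ ℕ._≟_ (∈-++⁺ʳ (map x ws) (∈-map⁺ y (∈-lookup {xs = ws} i)))

  values-Q : All Q values
  values-Q = All.tabulate λ v∈ → All.lookup
    (All.++⁺ (All.map⁺ (All.map proj₁ qs)) (All.map⁺ (All.map proj₂ qs)))
    (∈-deduplicate⁻ ℕ._≟_ all-values v∈)

  code : Fin (length ws) → Fin (length values * length values)
  code i = combine (index (x∈ i)) (index (y∈ i))

  code-injective : Injective _≡_ _≡_ code
  code-injective {i} {j} e with ex , ey ← combine-injective (index (x∈ i)) (index (y∈ i)) (index (x∈ j)) (index (y∈ j)) e =
    lookup-injective uws (determines
      (SetoidMembership.index-injective (setoid ℕ) (x∈ i) (x∈ j) ex)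
      (SetoidMembership.index-injective (setoid ℕ) (y∈ i) (y∈ j) ey))

-- Both counts must come from graphs with equally many vertices. An additional S realises t again on
-- 3 + m vertices, and an additional W realises 2t + f on as many.
planar-spectrum : ∀ m → ∃ λ N → length (words m) ≤ N * N × AtLeast (Tpla (3 + m)) N
planar-spectrum m = pigeonhole {Q = Tpla (3 + m)} (trees ∘ letters) (λ w → trees (W ∷ letters w)) (words m) (words-unique m)
  (λ {a} {b} ex ey → letters-injective a b (cong₂ _,_ ex (forests≡ ex ey)))
  (All.map (λ {w} len → subst (λ k → Tpla (3 + k) (trees (letters w))) len (trees∈Tpla (S ∷ letters w)) ,
                        subst (λ k → Tpla (3 + k) (trees (W ∷ letters w))) len (trees∈Tpla (W ∷ letters w)))
           (words-length m))
  where
  forests≡ : ∀ {t f t′ f′} → t ≡ t′ → t + (t + f) ≡ t′ + (t′ + f′) → f ≡ f′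
  forests≡ {t} {f} {_} {f′} refl e = +-cancelˡ-≡ t f f′ (+-cancelˡ-≡ t (t + f) (t + f′) e)

-- Comparing the growth rates

-- For q = 12 a + 17 b one Pell step gives 12 q′ + b = 29 q, so q grows by at most 29/12 = 1 +
-- 17/12, where 17/12 is a convergent of √2 from above.
pell-bound : ∀ n → 12 ^ n * (12 * pellA n + 17 * pellB n) ≤ 12 * 29 ^ n
pell-bound zero = ≤ᵇ⇒≤ _ _ tt
pell-bound (suc n) with pellAB n | pell-bound n
... | a , b | ih = begin
  12 * 12 ^ n * (12 * (a + 2 * b) + 17 * (a + b))     ≤⟨ m≤m+n _ (12 ^ n * b) ⟩
  12 * 12 ^ n * (12 * (a + 2 * b) + 17 * (a + b)) + 12 ^ n * b ≡⟨ regroup (12 ^ n) a b ⟩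
  29 * (12 ^ n * (12 * a + 17 * b))                   ≤⟨ *-monoʳ-≤ 29 ih ⟩
  29 * (12 * 29 ^ n)                                  ≡⟨ swap (29 ^ n) ⟩
  12 * (29 * 29 ^ n)                                  ∎
  where
  regroup : ∀ x a b → 12 * x * (12 * (a + 2 * b) + 17 * (a + b)) + x * b ≡ 29 * (x * (12 * a + 17 * b))
  regroup = solve-∀
  swap : ∀ x → 29 * (12 * x) ≡ 12 * (29 * x)
  swap = solve-∀

-- This is (88/87)^m ≥ 1 + m/87 without fractions, and 88/87 is the quotient of 22/9 by 29/12.
bernoulli : ∀ m → (87 + m) * 87 ^ m ≤ 87 * 88 ^ m
bernoulli zero = ≤-refl
bernoulli (suc m) = begin
  (88 + m) * (87 * 87 ^ m)              ≤⟨ m≤m+n _ (m * 87 ^ m) ⟩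
  (88 + m) * (87 * 87 ^ m) + m * 87 ^ m ≡⟨ regroup m (87 ^ m) ⟩
  88 * ((87 + m) * 87 ^ m)              ≤⟨ *-monoʳ-≤ 88 (bernoulli m) ⟩
  88 * (87 * 88 ^ m)                    ≡⟨ swap (88 ^ m) ⟩
  87 * (88 * 88 ^ m)                    ∎
  where
  regroup : ∀ m x → (88 + m) * (87 * x) + m * x ≡ 88 * ((87 + m) * x)
  regroup = solve-∀
  swap : ∀ x → 88 * (87 * x) ≡ 87 * (88 * x)
  swap = solve-∀

-- The value q = 12 a + 17 b bounds 12 (a + b √2), because 17/12 > √2.
ninety-percent : ∀ n N → 81 * (12 * pellA n + 17 * pellB n) ≤ 1200 * (N * N) → NinetyPercentCPowLe n N
ninety-percent n N h = 81a≤ , *-cancelˡ-≤ 144 (begin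
  144 * (2 * (b * b))      ≤⟨ m≤m+n _ (b * b) ⟩
  144 * (2 * (b * b)) + b * b ≡⟨ square17 b ⟩
  17 * b * (17 * b)        ≤⟨ *-mono-≤ 17b≤ 17b≤ ⟩
  12 * d * (12 * d)        ≡⟨ square12 d ⟩
  144 * (d * d)            ∎)
  where
  a = 81 * pellA n
  b = 81 * pellB n
  d = 100 * (N * N) ∸ a

  expand : ∀ x y → 12 * (81 * x) + 17 * (81 * y) ≡ 81 * (12 * x + 17 * y)
  expand = solve-∀
  split : ∀ x → 1200 * x ≡ 12 * (100 * x)
  split = solve-∀
  square17 : ∀ b → 144 * (2 * (b * b)) + b * b ≡ 17 * b * (17 * b)
  square17 = solve-∀
  square12 : ∀ d → 12 * d * (12 * d) ≡ 144 * (d * d)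
  square12 = solve-∀

  total : 12 * a + 17 * b ≤ 12 * (100 * (N * N))
  total = begin
    12 * a + 17 * b ≡⟨ expand (pellA n) (pellB n) ⟩
    81 * (12 * pellA n + 17 * pellB n) ≤⟨ h ⟩
    1200 * (N * N) ≡⟨ split (N * N) ⟩
    12 * (100 * (N * N)) ∎

  81a≤ : a ≤ 100 * (N * N)
  81a≤ = *-cancelˡ-≤ 12 (≤-trans (m≤m+n (12 * a) (17 * b)) total)

  17b≤ : 17 * b ≤ 12 * d
  17b≤ = begin
    17 * b                         ≤⟨ m+n≤o⇒m≤o∸n (17 * b) (subst (_≤ 12 * (100 * (N * N))) (+-comm (12 * a) (17 * b)) total) ⟩
    12 * (100 * (N * N)) ∸ 12 * a  ≡⟨ *-distribˡ-∸ 12 (100 * (N * N)) a ⟨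
    12 * d                         ∎

-- The bound

product-power : ∀ a b m → (a * b) ^ m ≡ a ^ m * b ^ m
product-power a b zero = refl
product-power a b (suc m) = trans (cong (a * b *_) (product-power a b m)) (regroup a b (a ^ m) (b ^ m))
  where
  regroup : ∀ a b x y → a * b * (x * y) ≡ a * x * (b * y)
  regroup = solve-∀

-- 412 exceeds 81 · 36 · 29³ / (100 · 12³), the product of all constants lost elsewhere.
power-comparison : ∀ m → 87 * 412 ≤ m → 412 * (29 ^ m * 9 ^ m) ≤ 12 ^ m * 22 ^ m
power-comparison m m≥ = begin
  412 * (29 ^ m * 9 ^ m)   ≡⟨ cong (412 *_) (rebase 29 9 3 87 refl) ⟩
  412 * (3 ^ m * 87 ^ m)   ≡⟨ swap 412 (3 ^ m) (87 ^ m) ⟩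
  3 ^ m * (412 * 87 ^ m)   ≤⟨ *-monoʳ-≤ (3 ^ m) (dominated 412 (87 ^ m) (88 ^ m) m≥ (bernoulli m)) ⟩
  3 ^ m * 88 ^ m           ≡⟨ rebase 3 88 12 22 refl ⟩
  12 ^ m * 22 ^ m          ∎
  where
  rebase : ∀ a b c d → a * b ≡ c * d → a ^ m * b ^ m ≡ c ^ m * d ^ m
  rebase a b c d e = trans (sym (product-power a b m)) (trans (cong (_^ m) e) (product-power c d m))
  swap : ∀ a b c → a * (b * c) ≡ b * (a * c)
  swap = solve-∀
  dominated : ∀ k x y → 87 * k ≤ m → (87 + m) * x ≤ 87 * y → k * x ≤ y
  dominated k x y k≤ bound = *-cancelˡ-≤ 87 (begin
    87 * (k * x) ≡⟨ *-assoc 87 k x ⟨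
    87 * k * x   ≤⟨ *-monoˡ-≤ x (≤-trans k≤ (m≤n+m m 87)) ⟩
    (87 + m) * x ≤⟨ bound ⟩
    87 * y       ∎)

-- Meant for `a` , `b` the third powers of 12 , 29, for `x` , `z` , `p` , `r` the m-th powers of 12
-- , 22 , 29 , 9, and for `s` = N². The constants of the two growth estimates meet in the single
-- numerical inequality on `a` and `b`.
growth-beats-pell : ∀ a b x z p r s q → 0 < a → 0 < x → 0 < z →
  81 * (12 * (b * 36)) ≤ 1200 * (a * 412) →
  a * x * q ≤ 12 * (b * p) → z ≤ 36 * r * s → 412 * (p * r) ≤ x * z → 81 * q ≤ 1200 * s
growth-beats-pell a b x z p r s q a>0 x>0 z>0 h₀ h₁ h₂ h₃ =
  *-cancelˡ-≤ (a * (x * z)) {{>-nonZero (*-mono-≤ a>0 (*-mono-≤ x>0 z>0))}} (begin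
    a * (x * z) * (81 * q)                    ≡⟨ e₁ a x z q 81 ⟩
    81 * z * (a * x * q)                      ≤⟨ *-monoʳ-≤ (81 * z) h₁ ⟩
    81 * z * (12 * (b * p))                   ≡⟨ e₂ b z p 81 12 ⟩
    81 * (12 * b) * p * z                     ≤⟨ *-monoʳ-≤ (81 * (12 * b) * p) h₂ ⟩
    81 * (12 * b) * p * (36 * r * s)          ≡⟨ e₃ b p r s 81 12 36 ⟩
    81 * (12 * (b * 36)) * (p * r * s)        ≤⟨ *-monoˡ-≤ (p * r * s) h₀ ⟩
    1200 * (a * 412) * (p * r * s)            ≡⟨ e₄ a p r s 1200 412 ⟩
    1200 * a * s * (412 * (p * r))            ≤⟨ *-monoʳ-≤ (1200 * a * s) h₃ ⟩
    1200 * a * s * (x * z)                    ≡⟨ e₅ a s (x * z) 1200 ⟩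
    a * (x * z) * (1200 * s)                  ∎)
  where
  e₁ : ∀ a x z q c → a * (x * z) * (c * q) ≡ c * z * (a * x * q)
  e₁ = solve-∀
  e₂ : ∀ b z p c d → c * z * (d * (b * p)) ≡ c * (d * b) * p * z
  e₂ = solve-∀
  e₃ : ∀ b p r s c d e → c * (d * b) * p * (e * r * s) ≡ c * (d * (b * e)) * (p * r * s)
  e₃ = solve-∀
  e₄ : ∀ a p r s c d → c * (a * d) * (p * r * s) ≡ c * a * s * (d * (p * r))
  e₄ = solve-∀
  e₅ : ∀ a s y c → c * a * s * y ≡ a * y * (c * s)
  e₅ = solve-∀

-- An equation for `n` instead of 3 + m itself keeps `pellA n` and `pellB n` from unfolding. The
-- offset 3 is the initial edge together with the additional letter.
planar-bound : ∀ n m → n ≡ 3 + m → 87 * 412 ≤ m → ∃ λ N → NinetyPercentCPowLe n N × AtLeast (Tpla n) N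
planar-bound n m n≡ m≥ = let N , enough , spectrum = planar-spectrum m in
  N , ninety-percent n N
    (growth-beats-pell (12 ^ 3) (29 ^ 3) (12 ^ m) (22 ^ m) (29 ^ m) (9 ^ m) (N * N) (12 * pellA n + 17 * pellB n)
      (m^n>0 12 3) (m^n>0 12 m) (m^n>0 22 m) (≤ᵇ⇒≤ _ _ tt)
      (subst₂ (λ x p → x * (12 * pellA n + 17 * pellB n) ≤ 12 * p) (split 12) (split 29) (pell-bound n))
      (≤-trans (words-growth m) (*-monoʳ-≤ (36 * 9 ^ m) enough)) (power-comparison m m≥)) ,
  subst (λ k → AtLeast (Tpla k) N) (sym n≡) spectrum
  where
  split : ∀ b → b ^ n ≡ b ^ 3 * b ^ m
  split b = trans (cong (b ^_) n≡) (^-distribˡ-+-* b 3 m)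

theorem1p1 : Σ ℕ λ n₀ → ∀ (n : ℕ) → n ≥ n₀ →
    (∀ (N : ℕ) → AtLeast (Tpla n) N → AtLeast (Tall n) N) ×
    (Σ ℕ λ N → NinetyPercentCPowLe n N × AtLeast (Tpla n) N)
theorem1p1 = 3 + 87 * 412 , λ n n≥ →
  (λ N (f , inj , mem) → f , inj , λ i → planar⇒all (mem i)) ,
  bound (87 * 412) {λ n → Σ ℕ λ N → NinetyPercentCPowLe n N × AtLeast (Tpla n) N} planar-bound n n≥
  where
  planar⇒all : ∀ {n k} → Tpla n k → Tall n k
  planar⇒all (G , simple , _ , count) = G , simple , count

  -- With an abstract threshold `k`, three successors are split off while 87 · 412 remains folded.
  bound : ∀ k {Q : ℕ → Set} → (∀ n m → n ≡ 3 + m → k ≤ m → Q n) → ∀ n → n ≥ 3 + k → Q n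
  bound k f n (s≤s (s≤s (s≤s k≤m))) = f n _ refl k≤m
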